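{- Let $\mathbf{k}$ be a commutative ring, let $k>0$ and $n\geq k$ be integers, and let $a_1,a_2,\ldots,a_k\in\mathbf{k}$. Let $\mathcal{S}$ be the ring of symmetric polynomials in $\mathbf{k}[x_1,\ldots,x_k]$, and let $I$ be the ideal of $\mathcal{S}$ generated by $h_{n-k+1}-a_1,\ h_{n-k+2}-a_2,\ \ldots,\ h_n-a_k$. Let $V$ be the set of all $k$-tuples $(-n,\tau_2,\tau_3,\ldots,\tau_k)\in\mathbb{Z}^k$ satisfying $\tau_i\in\{0,1\}$ for each $i\in\{2,3,\ldots,k\}$. Let $\mu$ be a partition with at most $k$ parts (regarded as a $k$-tuple in $\mathbb{N}^k$) such that $\mu_1>n-k$. Then, in $\mathcal{S}/I$, \[ \overline{s_\mu}=\sum_{j=1}^{k}(-1)^{k-j}a_j\sum_{\substack{\tau\in V;\\ -|\tau|=n-k+j}}\overline{s_{\mu+\tau}}. \]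
   Context: For $m\in\mathbb{Z}$, $h_m$ is the $m$-th complete homogeneous symmetric polynomial in $x_1,\ldots,x_k$ (with $h_0=1$, and $h_m=0$ for $m<0$). For any $\lambda=(\lambda_1,\ldots,\lambda_k)\in\mathbb{Z}^k$, define $s_\lambda=\det\left((h_{\lambda_u-u+v})_{1\leq u\leq k,\ 1\leq v\leq k}\right)\in\mathcal{S}$; when $\lambda$ is a partition with at most $k$ parts, this is the usual Schur polynomial $s_\lambda(x_1,\ldots,x_k)$. Addition on $\mathbb{Z}^k$ is entrywise, and $|\tau|$ denotes the sum of the entries of $\tau\in\mathbb{Z}^k$. $\overline{m}$ denotes the residue class of $m\in\mathcal{S}$ in $\mathcal{S}/I$. -}

module Defs where

open import Algebra.Bundles using (CommutativeRing)
import Algebra.Properties.CommutativeMonoid.Sum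
import Algebra.Properties.Ring
import Algebra.Properties.Semiring.Exp
import Algebra.Properties.Semiring.Sum
import Data.Integer as ℤ
open import Data.Integer using (ℤ; +_; -[1+_]; 0ℤ; 1ℤ)
open import Data.Fin using (Fin; zero; suc; toℕ; punchIn)
open import Data.Fin.Permutation as Perm using (Permutation′; _⟨$⟩ˡ_; _⟨$⟩ʳ_)
open import Data.List as List using (List; []; _∷_; _++_; map; foldr; filter; cartesianProductWith)
import Data.Nat as ℕ
open import Data.Nat using (ℕ; zero; suc; _≥_; _∸_)
import Data.Nat.Properties as ℕₚ
open import Data.Product using (Σ; ∃; _×_; _,_; proj₁; proj₂)
open import Data.Vec as Vec using (Vec; []; _∷_; lookup; tabulate; zipWith; replicate)
import Data.Vec.Properties as Vecₚ
open import Data.Vec.Relation.Unary.Linked using (Linked)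
open import Level using (_⊔_)
open import Relation.Binary.PropositionalEquality as ≡ using (_≡_)
import Relation.Binary.Reasoning.Setoid
open import Relation.Nullary using (Dec; yes; no; contradiction)

------------------------------------------------------------------------
-- Exponent vectors: e stands for the monomial x₁^e₁ ⋯ x_k^e_k

Exp : ℕ → Set
Exp k = Vec ℕ k

module _ {k : ℕ} where

  infixl 6 _⊕_

  _⊕_ : Exp k → Exp k → Exp k
  _⊕_ = zipWith ℕ._+_

  𝟘 : Exp k
  𝟘 = replicate k 0

  infix 4 _≟ᵉ_

  _≟ᵉ_ : (e f : Exp k) → Dec (e ≡ f)
  _≟ᵉ_ = Vecₚ.≡-dec ℕₚ._≟_

  -- The substitution x_i ↦ x_{σ i}: the new exponent of x_j is the old
  -- exponent of x_{σ⁻¹ j}.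
  permute : Permutation′ k → Exp k → Exp k
  permute σ e = tabulate (λ j → lookup e (σ ⟨$⟩ˡ j))

  ⊕-assoc : ∀ e f g → (e ⊕ f) ⊕ g ≡ e ⊕ (f ⊕ g)
  ⊕-assoc = Vecₚ.zipWith-assoc ℕₚ.+-assoc

  ⊕-comm : ∀ e f → e ⊕ f ≡ f ⊕ e
  ⊕-comm = Vecₚ.zipWith-comm ℕₚ.+-comm

  ⊕-identityˡ : ∀ e → 𝟘 ⊕ e ≡ e
  ⊕-identityˡ = Vecₚ.zipWith-identityˡ ℕₚ.+-identityˡ

  permute-⊕ : ∀ σ e f → permute σ (e ⊕ f) ≡ permute σ e ⊕ permute σ f
  permute-⊕ σ e f = ≡.trans
    (Vecₚ.tabulate-cong (λ j → Vecₚ.lookup-zipWith ℕ._+_ (σ ⟨$⟩ˡ j) e f))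
    (tabulate-⊕ (λ j → lookup e (σ ⟨$⟩ˡ j)) (λ j → lookup f (σ ⟨$⟩ˡ j)))
    where
    tabulate-⊕ : ∀ {m} (u v : Fin m → ℕ) →
                 tabulate (λ j → u j ℕ.+ v j) ≡ zipWith ℕ._+_ (tabulate u) (tabulate v)
    tabulate-⊕ {zero}  u v = ≡.refl
    tabulate-⊕ {suc m} u v = ≡.cong (u zero ℕ.+ v zero ∷_)
      (tabulate-⊕ (λ j → u (suc j)) (λ j → v (suc j)))

  permute-𝟘 : ∀ σ → permute σ 𝟘 ≡ 𝟘
  permute-𝟘 σ = ≡.trans
    (Vecₚ.tabulate-cong (λ j → ≡.trans (Vecₚ.lookup-replicate (σ ⟨$⟩ˡ j) 0)
                                        (≡.sym (Vecₚ.lookup-replicate j 0))))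
    (Vecₚ.tabulate∘lookup 𝟘)

  permute-flip : ∀ σ e → permute σ (permute (Perm.flip σ) e) ≡ e
  permute-flip σ e = ≡.trans
    (Vecₚ.tabulate-cong (λ j → ≡.trans
      (Vecₚ.lookup∘tabulate (λ i → lookup e (σ ⟨$⟩ʳ i)) (σ ⟨$⟩ˡ j))
      (≡.cong (lookup e) (Perm.inverseʳ σ))))
    (Vecₚ.tabulate∘lookup e)

  permute-flip′ : ∀ σ e → permute (Perm.flip σ) (permute σ e) ≡ e
  permute-flip′ σ e = ≡.trans
    (Vecₚ.tabulate-cong (λ j → ≡.trans
      (Vecₚ.lookup∘tabulate (λ i → lookup e (σ ⟨$⟩ˡ i)) (σ ⟨$⟩ʳ j))
      (≡.cong (lookup e) (Perm.inverseˡ σ))))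
    (Vecₚ.tabulate∘lookup e)

⊕-solve : ∀ {k} (e f : Exp k) {m} → e ⊕ f ≡ m → f ≡ zipWith _∸_ m e
⊕-solve []      []      ≡.refl = ≡.refl
⊕-solve (x ∷ e) (y ∷ f) ≡.refl =
  ≡.cong₂ _∷_ (≡.sym (ℕₚ.m+n∸m≡n x y)) (⊕-solve e f ≡.refl)

incr : ∀ {k} → Exp (suc k) → Exp (suc k)
incr (i ∷ e) = suc i ∷ e

-- All exponent vectors of total degree m, each listed once: for m > 0, those
-- whose first entry is 0, followed by those whose first entry is positive.
exponents : ∀ k → ℕ → List (Exp k)
exponents zero    zero    = [] ∷ []
exponents zero    (suc m) = []
exponents (suc k) zero    = map (0 ∷_) (exponents k zero)
exponents (suc k) (suc m) = map (0 ∷_) (exponents k (suc m)) ++ map incr (exponents (suc k) m)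

degree : ∀ {k} → Exp k → ℕ
degree = Vec.foldr _ ℕ._+_ 0

degree-permute : ∀ {k} (σ : Permutation′ k) e → degree (permute σ e) ≡ degree e
degree-permute σ e = begin
  degree (permute σ e)                 ≡⟨ degree-tabulate (λ j → lookup e (σ ⟨$⟩ˡ j)) ⟩
  sum (λ j → lookup e (σ ⟨$⟩ˡ j))      ≡⟨ sum-permute (lookup e) (Perm.flip σ) ⟨
  sum (lookup e)                       ≡⟨ degree-tabulate (lookup e) ⟨
  degree (tabulate (lookup e))         ≡⟨ ≡.cong degree (Vecₚ.tabulate∘lookup e) ⟩
  degree e                             ∎
  where
  open ≡.≡-Reasoning
  open Algebra.Properties.CommutativeMonoid.Sum ℕₚ.+-0-commutativeMonoid using (sum; sum-permute)

  degree-tabulate : ∀ {m} (u : Fin m → ℕ) → degree (tabulate u) ≡ sum u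
  degree-tabulate {zero}  u = ≡.refl
  degree-tabulate {suc m} u = ≡.cong (u zero ℕ.+_) (degree-tabulate (λ j → u (suc j)))

------------------------------------------------------------------------
-- The polynomial ring 𝐤[x₁,…,x_k]
--
-- A polynomial is a formal sum of terms (c , e) = c x^e; monomials may repeat
-- and coefficients may vanish, and two formal sums are identified when all
-- their collected coefficients agree.

module Polynomials {c ℓ} (𝐤 : CommutativeRing c ℓ) (k : ℕ) where

  private
    module K = CommutativeRing 𝐤
    module KR = Algebra.Properties.Ring K.ring
  open Relation.Binary.Reasoning.Setoid K.setoid

  Poly : Set c
  Poly = List (K.Carrier × Exp k)

  -- The sum of c · φ e over the terms c x^e of a formal sum.
  eval : Poly → (Exp k → K.Carrier) → K.Carrier
  eval []            φ = K.0#
  eval ((c , e) ∷ p) φ = c K.* φ e K.+ eval p φ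

  δ : Exp k → Exp k → K.Carrier
  δ m e with e ≟ᵉ m
  ... | yes _ = K.1#
  ... | no  _ = K.0#

  coeff : Poly → Exp k → K.Carrier
  coeff p m = eval p (δ m)

  infix  4 _≈ᵖ_
  infixl 6 _+ᵖ_
  infixl 7 _*ᵖ_
  infix  8 -ᵖ_

  -- A record, so that both polynomials can be inferred from an equality.
  record _≈ᵖ_ (p q : Poly) : Set ℓ where
    constructor mk≈
    field coeff≈ : ∀ m → coeff p m K.≈ coeff q m
  open _≈ᵖ_ public

  _*ᵗ_ : K.Carrier × Exp k → K.Carrier × Exp k → K.Carrier × Exp k
  (c , e) *ᵗ (d , f) = c K.* d , e ⊕ f

  const : K.Carrier → Poly
  const c = (c , 𝟘) ∷ []

  0ᵖ 1ᵖ : Poly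
  0ᵖ = []
  1ᵖ = const K.1#

  _+ᵖ_ _*ᵖ_ : Poly → Poly → Poly
  _+ᵖ_ = _++_
  _*ᵖ_ = cartesianProductWith _*ᵗ_

  -ᵖ_ : Poly → Poly
  -ᵖ_ = map (λ (c , e) → K.- c , e)

  permuteᵖ : Permutation′ k → Poly → Poly
  permuteᵖ σ = map (λ (c , e) → c , permute σ e)

  eval-cong : ∀ p {φ ψ} → (∀ e → φ e K.≈ ψ e) → eval p φ K.≈ eval p ψ
  eval-cong []            h = K.refl
  eval-cong ((c , e) ∷ p) h = K.+-cong (K.*-congˡ (h e)) (eval-cong p h)

  eval-zero : ∀ p → eval p (λ _ → K.0#) K.≈ K.0#
  eval-zero []            = K.refl
  eval-zero ((c , e) ∷ p) = K.trans (K.+-cong (K.zeroʳ c) (eval-zero p)) (K.+-identityʳ _)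

  eval-+ : ∀ p q φ → eval (p +ᵖ q) φ K.≈ eval p φ K.+ eval q φ
  eval-+ []            q φ = K.sym (K.+-identityˡ _)
  eval-+ ((c , e) ∷ p) q φ = K.trans (K.+-congˡ (eval-+ p q φ)) (K.sym (K.+-assoc _ _ _))

  eval-neg : ∀ p φ → eval (-ᵖ p) φ K.≈ K.- eval p φ
  eval-neg []            φ = K.sym KR.-0#≈0#
  eval-neg ((c , e) ∷ p) φ = begin
    K.- c K.* φ e K.+ eval (-ᵖ p) φ    ≈⟨ K.+-cong (K.sym (KR.-‿distribˡ-* c (φ e))) (eval-neg p φ) ⟩
    K.- (c K.* φ e) K.+ K.- eval p φ   ≈⟨ KR.-‿+-comm _ _ ⟩
    K.- (c K.* φ e K.+ eval p φ)       ∎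

  eval-linear : ∀ q c φ ψ →
    eval q (λ f → c K.* φ f K.+ ψ f) K.≈ c K.* eval q φ K.+ eval q ψ
  eval-linear []            c φ ψ =
    K.sym (K.trans (K.+-identityʳ _) (K.zeroʳ c))
  eval-linear ((d , f) ∷ q) c φ ψ = begin
    d K.* (c K.* φ f K.+ ψ f) K.+ eval q (λ g → c K.* φ g K.+ ψ g)
      ≈⟨ K.+-cong (K.distribˡ d _ _) (eval-linear q c φ ψ) ⟩
    (d K.* (c K.* φ f) K.+ d K.* ψ f) K.+ (c K.* eval q φ K.+ eval q ψ)
      ≈⟨ interchange _ _ _ _ ⟩
    (d K.* (c K.* φ f) K.+ c K.* eval q φ) K.+ (d K.* ψ f K.+ eval q ψ)
      ≈⟨ K.+-congʳ (K.+-congʳ (x∙yz≈y∙xz d c (φ f))) ⟩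
    (c K.* (d K.* φ f) K.+ c K.* eval q φ) K.+ (d K.* ψ f K.+ eval q ψ)
      ≈⟨ K.+-congʳ (K.distribˡ c _ _) ⟨
    c K.* (d K.* φ f K.+ eval q φ) K.+ (d K.* ψ f K.+ eval q ψ) ∎
    where
    open import Algebra.Properties.CommutativeSemigroup K.+-commutativeSemigroup using (interchange)
    open import Algebra.Properties.CommutativeSemigroup K.*-commutativeSemigroup using (x∙yz≈y∙xz)

  eval-swap : ∀ p q (F : Exp k → Exp k → K.Carrier) →
    eval p (λ e → eval q (F e)) K.≈ eval q (λ f → eval p (λ e → F e f))
  eval-swap []            q F = K.sym (eval-zero q)
  eval-swap ((c , e) ∷ p) q F = begin
    c K.* eval q (F e) K.+ eval p (λ e → eval q (F e))
      ≈⟨ K.+-congˡ (eval-swap p q F) ⟩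
    c K.* eval q (F e) K.+ eval q (λ f → eval p (λ e → F e f))
      ≈⟨ eval-linear q c (F e) (λ f → eval p (λ e → F e f)) ⟨
    eval q (λ f → c K.* F e f K.+ eval p (λ e → F e f)) ∎

  eval-* : ∀ p q φ → eval (p *ᵖ q) φ K.≈ eval p (λ e → eval q (λ f → φ (e ⊕ f)))
  eval-* []            q φ = K.refl
  eval-* ((c , e) ∷ p) q φ =
    K.trans (eval-+ (map ((c , e) *ᵗ_) q) (p *ᵖ q) φ) (K.+-cong (eval-*ᵗ q) (eval-* p q φ))
    where
    eval-*ᵗ : ∀ q → eval (map ((c , e) *ᵗ_) q) φ K.≈ c K.* eval q (λ f → φ (e ⊕ f))
    eval-*ᵗ []            = K.sym (K.zeroʳ c)
    eval-*ᵗ ((d , f) ∷ q) = K.trans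
      (K.+-cong (K.*-assoc c d _) (eval-*ᵗ q)) (K.sym (K.distribˡ c _ _))

  eval-const : ∀ c φ → eval (const c) φ K.≈ c K.* φ 𝟘
  eval-const c φ = K.+-identityʳ _

  eval-permute : ∀ σ p φ → eval (permuteᵖ σ p) φ K.≈ eval p (λ e → φ (permute σ e))
  eval-permute σ []            φ = K.refl
  eval-permute σ ((c , e) ∷ p) φ = K.+-congˡ (eval-permute σ p φ)

  δ-transport : ∀ {m e m′ e′} → (e ≡ m → e′ ≡ m′) → (e′ ≡ m′ → e ≡ m) → δ m e K.≈ δ m′ e′
  δ-transport {m} {e} {m′} {e′} to from with e ≟ᵉ m | e′ ≟ᵉ m′
  ... | yes _ | yes _ = K.refl
  ... | yes a | no  b = contradiction (to a) b
  ... | no  a | yes b = contradiction (from b) a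
  ... | no  _ | no  _ = K.refl

  δ-≢ : ∀ {m e} → (e ≡ m → K.1# K.≈ K.0#) → δ m e K.≈ K.0#
  δ-≢ {m} {e} h with e ≟ᵉ m
  ... | yes a = h a
  ... | no  _ = K.refl

  eval-shift : ∀ {p q} → p ≈ᵖ q → ∀ m e → eval p (λ f → δ m (e ⊕ f)) K.≈ eval q (λ f → δ m (e ⊕ f))
  eval-shift {p} {q} p≈q m e with e ⊕ zipWith _∸_ m e ≟ᵉ m
  ... | yes eq = begin
    eval p (λ f → δ m (e ⊕ f))  ≈⟨ eval-cong p shift ⟩
    coeff p (zipWith _∸_ m e)   ≈⟨ coeff≈ p≈q _ ⟩
    coeff q (zipWith _∸_ m e)   ≈⟨ eval-cong q shift ⟨
    eval q (λ f → δ m (e ⊕ f))  ∎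
    where
    shift : ∀ f → δ m (e ⊕ f) K.≈ δ (zipWith _∸_ m e) f
    shift f = δ-transport (⊕-solve e f)
                          (λ f≡ → ≡.trans (≡.cong (e ⊕_) f≡) eq)
  ... | no neq = begin
    eval p (λ f → δ m (e ⊕ f))  ≈⟨ eval-cong p vanish ⟩
    eval p (λ _ → K.0#)         ≈⟨ eval-zero p ⟩
    K.0#                        ≈⟨ eval-zero q ⟨
    eval q (λ _ → K.0#)         ≈⟨ eval-cong q vanish ⟨
    eval q (λ f → δ m (e ⊕ f))  ∎
    where
    vanish : ∀ f → δ m (e ⊕ f) K.≈ K.0#
    vanish f = δ-≢ (λ e⊕f≡m → contradiction
      (≡.trans (≡.cong (e ⊕_) (≡.sym (⊕-solve e f e⊕f≡m))) e⊕f≡m) neq)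

  private
    δ-≡ : ∀ m {e f} → e ≡ f → δ m e K.≈ δ m f
    δ-≡ m ≡.refl = K.refl

  ≈ᵖ-refl : ∀ {p} → p ≈ᵖ p
  ≈ᵖ-refl = mk≈ λ m → K.refl

  ≈ᵖ-sym : ∀ {p q} → p ≈ᵖ q → q ≈ᵖ p
  ≈ᵖ-sym h = mk≈ λ m → K.sym (coeff≈ h m)

  ≈ᵖ-trans : ∀ {p q r} → p ≈ᵖ q → q ≈ᵖ r → p ≈ᵖ r
  ≈ᵖ-trans h i = mk≈ λ m → K.trans (coeff≈ h m) (coeff≈ i m)

  +ᵖ-cong : ∀ {p p′ q q′} → p ≈ᵖ p′ → q ≈ᵖ q′ → p +ᵖ q ≈ᵖ p′ +ᵖ q′
  +ᵖ-cong {p} {p′} {q} {q′} h i = mk≈ λ m → begin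
    coeff (p +ᵖ q) m            ≈⟨ eval-+ p q _ ⟩
    coeff p m K.+ coeff q m     ≈⟨ K.+-cong (coeff≈ h m) (coeff≈ i m) ⟩
    coeff p′ m K.+ coeff q′ m   ≈⟨ eval-+ p′ q′ _ ⟨
    coeff (p′ +ᵖ q′) m          ∎

  +ᵖ-assoc : ∀ p q r → (p +ᵖ q) +ᵖ r ≈ᵖ p +ᵖ (q +ᵖ r)
  +ᵖ-assoc p q r = mk≈ λ m → begin
    coeff ((p +ᵖ q) +ᵖ r) m                   ≈⟨ K.trans (eval-+ (p +ᵖ q) r _) (K.+-congʳ (eval-+ p q _)) ⟩
    (coeff p m K.+ coeff q m) K.+ coeff r m   ≈⟨ K.+-assoc _ _ _ ⟩
    coeff p m K.+ (coeff q m K.+ coeff r m)   ≈⟨ K.trans (eval-+ p (q +ᵖ r) _) (K.+-congˡ (eval-+ q r _)) ⟨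
    coeff (p +ᵖ (q +ᵖ r)) m                   ∎

  +ᵖ-comm : ∀ p q → p +ᵖ q ≈ᵖ q +ᵖ p
  +ᵖ-comm p q = mk≈ λ m → begin
    coeff (p +ᵖ q) m          ≈⟨ eval-+ p q _ ⟩
    coeff p m K.+ coeff q m   ≈⟨ K.+-comm _ _ ⟩
    coeff q m K.+ coeff p m   ≈⟨ eval-+ q p _ ⟨
    coeff (q +ᵖ p) m          ∎

  +ᵖ-identityˡ : ∀ p → 0ᵖ +ᵖ p ≈ᵖ p
  +ᵖ-identityˡ p = ≈ᵖ-refl

  -ᵖ-cong : ∀ {p q} → p ≈ᵖ q → -ᵖ p ≈ᵖ -ᵖ q
  -ᵖ-cong {p} {q} h = mk≈ λ m → begin
    coeff (-ᵖ p) m    ≈⟨ eval-neg p _ ⟩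
    K.- coeff p m     ≈⟨ K.-‿cong (coeff≈ h m) ⟩
    K.- coeff q m     ≈⟨ eval-neg q _ ⟨
    coeff (-ᵖ q) m    ∎

  -ᵖ-inverseˡ : ∀ p → -ᵖ p +ᵖ p ≈ᵖ 0ᵖ
  -ᵖ-inverseˡ p = mk≈ λ m → begin
    coeff (-ᵖ p +ᵖ p) m             ≈⟨ K.trans (eval-+ (-ᵖ p) p _) (K.+-congʳ (eval-neg p _)) ⟩
    K.- coeff p m K.+ coeff p m     ≈⟨ K.-‿inverseˡ _ ⟩
    K.0#                            ∎

  *ᵖ-comm : ∀ p q → p *ᵖ q ≈ᵖ q *ᵖ p
  *ᵖ-comm p q = mk≈ λ m → begin
    coeff (p *ᵖ q) m                            ≈⟨ eval-* p q _ ⟩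
    eval p (λ e → eval q (λ f → δ m (e ⊕ f)))   ≈⟨ eval-swap p q _ ⟩
    eval q (λ f → eval p (λ e → δ m (e ⊕ f)))   ≈⟨ eval-cong q (λ f → eval-cong p (λ e → δ-≡ m (⊕-comm e f))) ⟩
    eval q (λ f → eval p (λ e → δ m (f ⊕ e)))   ≈⟨ eval-* q p _ ⟨
    coeff (q *ᵖ p) m                            ∎

  *ᵖ-congˡ : ∀ {p q q′} → q ≈ᵖ q′ → p *ᵖ q ≈ᵖ p *ᵖ q′
  *ᵖ-congˡ {p} {q} {q′} h = mk≈ λ m → begin
    coeff (p *ᵖ q) m                             ≈⟨ eval-* p q _ ⟩
    eval p (λ e → eval q (λ f → δ m (e ⊕ f)))    ≈⟨ eval-cong p (eval-shift h m) ⟩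
    eval p (λ e → eval q′ (λ f → δ m (e ⊕ f)))   ≈⟨ eval-* p q′ _ ⟨
    coeff (p *ᵖ q′) m                            ∎

  *ᵖ-cong : ∀ {p p′ q q′} → p ≈ᵖ p′ → q ≈ᵖ q′ → p *ᵖ q ≈ᵖ p′ *ᵖ q′
  *ᵖ-cong {p} {p′} {q} {q′} h i =
    ≈ᵖ-trans (*ᵖ-congˡ {p} i)
      (≈ᵖ-trans (*ᵖ-comm p q′) (≈ᵖ-trans (*ᵖ-congˡ {q′} h) (*ᵖ-comm q′ p′)))

  *ᵖ-assoc : ∀ p q r → (p *ᵖ q) *ᵖ r ≈ᵖ p *ᵖ (q *ᵖ r)
  *ᵖ-assoc p q r = mk≈ λ m → begin
    coeff ((p *ᵖ q) *ᵖ r) m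
      ≈⟨ K.trans (eval-* (p *ᵖ q) r _) (eval-* p q _) ⟩
    eval p (λ e → eval q (λ f → eval r (λ g → δ m ((e ⊕ f) ⊕ g))))
      ≈⟨ eval-cong p (λ e → eval-cong q (λ f → eval-cong r (λ g → δ-≡ m (⊕-assoc e f g)))) ⟩
    eval p (λ e → eval q (λ f → eval r (λ g → δ m (e ⊕ (f ⊕ g)))))
      ≈⟨ K.trans (eval-* p (q *ᵖ r) _) (eval-cong p (λ e → eval-* q r _)) ⟨
    coeff (p *ᵖ (q *ᵖ r)) m ∎

  *ᵖ-identityˡ : ∀ p → 1ᵖ *ᵖ p ≈ᵖ p
  *ᵖ-identityˡ p = mk≈ λ m → begin
    coeff (1ᵖ *ᵖ p) m                        ≈⟨ eval-* 1ᵖ p _ ⟩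
    eval 1ᵖ (λ e → eval p (λ f → δ m (e ⊕ f)))  ≈⟨ eval-const K.1# (λ e → eval p (λ f → δ m (e ⊕ f))) ⟩
    K.1# K.* eval p (λ f → δ m (𝟘 ⊕ f))      ≈⟨ K.*-identityˡ _ ⟩
    eval p (λ f → δ m (𝟘 ⊕ f))               ≈⟨ eval-cong p (λ f → δ-≡ m (⊕-identityˡ f)) ⟩
    coeff p m                                ∎

  *ᵖ-distribʳ-+ᵖ : ∀ p q r → (q +ᵖ r) *ᵖ p ≈ᵖ q *ᵖ p +ᵖ r *ᵖ p
  *ᵖ-distribʳ-+ᵖ p q r = mk≈ λ m → begin
    coeff ((q +ᵖ r) *ᵖ p) m
      ≈⟨ K.trans (eval-* (q +ᵖ r) p _) (eval-+ q r _) ⟩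
    eval q (λ e → eval p (λ f → δ m (e ⊕ f))) K.+ eval r (λ e → eval p (λ f → δ m (e ⊕ f)))
      ≈⟨ K.trans (eval-+ (q *ᵖ p) (r *ᵖ p) _) (K.+-cong (eval-* q p _) (eval-* r p _)) ⟨
    coeff (q *ᵖ p +ᵖ r *ᵖ p) m ∎

  polynomialRing : CommutativeRing c ℓ
  polynomialRing = record
    { Carrier = Poly ; _≈_ = _≈ᵖ_ ; _+_ = _+ᵖ_ ; _*_ = _*ᵖ_ ; -_ = -ᵖ_ ; 0# = 0ᵖ ; 1# = 1ᵖ
    ; isCommutativeRing = record
      { isRing = record
        { +-isAbelianGroup = record
          { isGroup = record
            { isMonoid = record
              { isSemigroup = record
                { isMagma = record
                  { isEquivalence = record { refl = ≈ᵖ-refl ; sym = ≈ᵖ-sym ; trans = ≈ᵖ-trans }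
                  ; ∙-cong = +ᵖ-cong }
                ; assoc = +ᵖ-assoc }
              ; identity = +ᵖ-identityˡ , λ p → ≈ᵖ-trans (+ᵖ-comm p 0ᵖ) (+ᵖ-identityˡ p) }
            ; inverse = -ᵖ-inverseˡ , λ p → ≈ᵖ-trans (+ᵖ-comm p (-ᵖ p)) (-ᵖ-inverseˡ p)
            ; ⁻¹-cong = -ᵖ-cong }
          ; comm = +ᵖ-comm }
        ; *-cong = *ᵖ-cong
        ; *-assoc = *ᵖ-assoc
        ; *-identity = *ᵖ-identityˡ , λ p → ≈ᵖ-trans (*ᵖ-comm p 1ᵖ) (*ᵖ-identityˡ p)
        ; distrib =
            (λ p q r → ≈ᵖ-trans (*ᵖ-comm p (q +ᵖ r)) (≈ᵖ-trans (*ᵖ-distribʳ-+ᵖ p q r)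
                         (+ᵖ-cong (*ᵖ-comm q p) (*ᵖ-comm r p))))
            , *ᵖ-distribʳ-+ᵖ }
      ; *-comm = *ᵖ-comm } }

  IsSymmetric : Poly → Set ℓ
  IsSymmetric p = ∀ (σ : Permutation′ k) → permuteᵖ σ p ≈ᵖ p

  const-symmetric : ∀ c → IsSymmetric (const c)
  const-symmetric c σ = mk≈ λ m → K.+-congʳ (K.*-congˡ (δ-≡ m (permute-𝟘 σ)))

  +ᵖ-symmetric : ∀ {p q} → IsSymmetric p → IsSymmetric q → IsSymmetric (p +ᵖ q)
  +ᵖ-symmetric {p} {q} sp sq σ = mk≈ λ m → begin
    coeff (permuteᵖ σ (p +ᵖ q)) m
      ≈⟨ K.trans (eval-permute σ (p +ᵖ q) _) (eval-+ p q _) ⟩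
    eval p (λ e → δ m (permute σ e)) K.+ eval q (λ e → δ m (permute σ e))
      ≈⟨ K.+-cong (eval-permute σ p _) (eval-permute σ q _) ⟨
    coeff (permuteᵖ σ p) m K.+ coeff (permuteᵖ σ q) m
      ≈⟨ K.+-cong (coeff≈ (sp σ) m) (coeff≈ (sq σ) m) ⟩
    coeff p m K.+ coeff q m
      ≈⟨ eval-+ p q _ ⟨
    coeff (p +ᵖ q) m ∎

  -ᵖ-symmetric : ∀ {p} → IsSymmetric p → IsSymmetric (-ᵖ p)
  -ᵖ-symmetric {p} sp σ = mk≈ λ m → begin
    coeff (permuteᵖ σ (-ᵖ p)) m            ≈⟨ K.trans (eval-permute σ (-ᵖ p) _) (eval-neg p _) ⟩
    K.- eval p (λ e → δ m (permute σ e))   ≈⟨ K.-‿cong (eval-permute σ p _) ⟨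
    K.- coeff (permuteᵖ σ p) m             ≈⟨ K.-‿cong (coeff≈ (sp σ) m) ⟩
    K.- coeff p m                          ≈⟨ eval-neg p _ ⟨
    coeff (-ᵖ p) m                         ∎

  *ᵖ-symmetric : ∀ {p q} → IsSymmetric p → IsSymmetric q → IsSymmetric (p *ᵖ q)
  *ᵖ-symmetric {p} {q} sp sq σ = ≈ᵖ-trans (mk≈ permute-*) (*ᵖ-cong (sp σ) (sq σ))
    where
    permute-* : ∀ m → coeff (permuteᵖ σ (p *ᵖ q)) m K.≈ coeff (permuteᵖ σ p *ᵖ permuteᵖ σ q) m
    permute-* m = begin
      coeff (permuteᵖ σ (p *ᵖ q)) m
        ≈⟨ K.trans (eval-permute σ (p *ᵖ q) _) (eval-* p q _) ⟩
      eval p (λ e → eval q (λ f → δ m (permute σ (e ⊕ f))))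
        ≈⟨ eval-cong p (λ e → eval-cong q (λ f → δ-≡ m (permute-⊕ σ e f))) ⟩
      eval p (λ e → eval q (λ f → δ m (permute σ e ⊕ permute σ f)))
        ≈⟨ eval-cong p (λ e → eval-permute σ q _) ⟨
      eval p (λ e → eval (permuteᵖ σ q) (λ f → δ m (permute σ e ⊕ f)))
        ≈⟨ eval-permute σ p _ ⟨
      eval (permuteᵖ σ p) (λ e → eval (permuteᵖ σ q) (λ f → δ m (e ⊕ f)))
        ≈⟨ eval-* (permuteᵖ σ p) (permuteᵖ σ q) _ ⟨
      coeff (permuteᵖ σ p *ᵖ permuteᵖ σ q) m ∎

  private module P = CommutativeRing polynomialRing

  -- 𝒮, the subring of symmetric polynomials.
  symmetricRing : CommutativeRing (c ⊔ ℓ) ℓ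
  symmetricRing = record
    { Carrier = Σ Poly IsSymmetric
    ; _≈_ = λ p q → proj₁ p ≈ᵖ proj₁ q
    ; _+_ = λ (p , sp) (q , sq) → p +ᵖ q , +ᵖ-symmetric {p} {q} sp sq
    ; _*_ = λ (p , sp) (q , sq) → p *ᵖ q , *ᵖ-symmetric {p} {q} sp sq
    ; -_  = λ (p , sp) → -ᵖ p , -ᵖ-symmetric {p} sp
    ; 0#  = 0ᵖ , λ σ → ≈ᵖ-refl
    ; 1#  = 1ᵖ , const-symmetric K.1#
    ; isCommutativeRing = record
      { isRing = record
        { +-isAbelianGroup = record
          { isGroup = record
            { isMonoid = record
              { isSemigroup = record
                { isMagma = record
                  { isEquivalence = record { refl = P.refl ; sym = P.sym ; trans = P.trans }
                  ; ∙-cong = P.+-cong }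
                ; assoc = λ p q r → P.+-assoc (proj₁ p) (proj₁ q) (proj₁ r) }
              ; identity = (λ p → P.+-identityˡ (proj₁ p)) , (λ p → P.+-identityʳ (proj₁ p)) }
            ; inverse = (λ p → P.-‿inverseˡ (proj₁ p)) , (λ p → P.-‿inverseʳ (proj₁ p))
            ; ⁻¹-cong = P.-‿cong }
          ; comm = λ p q → P.+-comm (proj₁ p) (proj₁ q) }
        ; *-cong = P.*-cong
        ; *-assoc = λ p q r → P.*-assoc (proj₁ p) (proj₁ q) (proj₁ r)
        ; *-identity = (λ p → P.*-identityˡ (proj₁ p)) , (λ p → P.*-identityʳ (proj₁ p))
        ; distrib = (λ p q r → P.distribˡ (proj₁ p) (proj₁ q) (proj₁ r))
                  , (λ p q r → P.distribʳ (proj₁ p) (proj₁ q) (proj₁ r)) }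
      ; *-comm = λ p q → P.*-comm (proj₁ p) (proj₁ q) } }

  constˢ : K.Carrier → CommutativeRing.Carrier symmetricRing
  constˢ c = const c , const-symmetric c

------------------------------------------------------------------------

module Complete {c ℓ} (𝐤 : CommutativeRing c ℓ) where

  private
    module K = CommutativeRing 𝐤
    module P k = Polynomials 𝐤 k
  open Relation.Binary.Reasoning.Setoid K.setoid

  hᵖ : ∀ k → ℕ → P.Poly k
  hᵖ k m = map (K.1# ,_) (exponents k m)

  [_≡?_] : ℕ → ℕ → K.Carrier
  [ i ≡? j ] with i ℕₚ.≟ j
  ... | yes _ = K.1#
  ... | no  _ = K.0#

  private
    count : ∀ {k} → List (Exp k) → Exp k → K.Carrier
    count {k} es = P.coeff k (map (K.1# ,_) es)

    count-++ : ∀ {k} es fs (e : Exp k) → count (es ++ fs) e K.≈ count es e K.+ count fs e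
    count-++ []       fs e = K.sym (K.+-identityˡ _)
    count-++ (f ∷ es) fs e = K.trans (K.+-congˡ (count-++ es fs e)) (K.sym (K.+-assoc _ _ _))

    count-map : ∀ {k l} (g : Exp k → Exp l) es e e′ →
                (∀ f → P.δ l e′ (g f) K.≈ P.δ k e f) → count (map g es) e′ K.≈ count es e
    count-map g []       e e′ h = K.refl
    count-map g (f ∷ es) e e′ h = K.+-cong (K.*-congˡ (h f)) (count-map g es e e′ h)

    count-none : ∀ {k l} (g : Exp k → Exp l) es e′ →
                 (∀ f → P.δ l e′ (g f) K.≈ K.0#) → count (map g es) e′ K.≈ K.0#
    count-none g []       e′ h = K.refl
    count-none g (f ∷ es) e′ h = K.trans
      (K.+-cong (K.trans (K.*-congˡ (h f)) (K.zeroʳ _)) (count-none g es e′ h)) (K.+-identityˡ _)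

    []-suc : ∀ i j → [ i ≡? j ] K.≈ [ suc i ≡? suc j ]
    []-suc i j with i ℕₚ.≟ j | suc i ℕₚ.≟ suc j
    ... | yes _ | yes _ = K.refl
    ... | yes a | no  b = contradiction (≡.cong suc a) b
    ... | no  a | yes b = contradiction (ℕₚ.suc-injective b) a
    ... | no  _ | no  _ = K.refl

    count-0∷ : ∀ {k} es (e : Exp k) → count (map (0 ∷_) es) (0 ∷ e) K.≈ count es e
    count-0∷ {k} es e = count-map (0 ∷_) es e (0 ∷ e)
      (λ f → aux f)
      where
      aux : ∀ f → P.δ (suc k) (0 ∷ e) (0 ∷ f) K.≈ P.δ k e f
      aux f with (0 ∷ f) ≟ᵉ (0 ∷ e) | f ≟ᵉ e
      ... | yes _ | yes _ = K.refl
      ... | yes a | no  b = contradiction (Vecₚ.∷-injectiveʳ a) b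
      ... | no  a | yes b = contradiction (≡.cong (0 ∷_) b) a
      ... | no  _ | no  _ = K.refl

    count-0∷-suc : ∀ {k} es i (e : Exp k) → count (map (0 ∷_) es) (suc i ∷ e) K.≈ K.0#
    count-0∷-suc es i e = count-none (0 ∷_) es (suc i ∷ e) (λ f → P.δ-≢ _ {suc i ∷ e} {0 ∷ f} (λ ()))

    count-incr : ∀ {k} es i (e : Exp k) → count (map incr es) (suc i ∷ e) K.≈ count es (i ∷ e)
    count-incr {k} es i e = count-map incr es (i ∷ e) (suc i ∷ e)
      λ { (j ∷ f) → P.δ-transport (suc k) {suc i ∷ e} {suc j ∷ f} {i ∷ e} {j ∷ f}
                      (λ { ≡.refl → ≡.refl }) (λ { ≡.refl → ≡.refl }) }

    count-incr-0 : ∀ {k} es (e : Exp k) → count (map incr es) (0 ∷ e) K.≈ K.0#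
    count-incr-0 {k} es e = count-none incr es (0 ∷ e)
      λ { (j ∷ f) → P.δ-≢ (suc k) {0 ∷ e} {suc j ∷ f} (λ ()) }

  -- h_m is the sum of all monomials of degree m, each with coefficient 1.
  coeff-h : ∀ k m e → P.coeff k (hᵖ k m) e K.≈ [ degree e ≡? m ]
  coeff-h zero    zero    []          = K.trans (K.+-identityʳ _) (K.*-identityˡ _)
  coeff-h zero    (suc m) []          = K.refl
  coeff-h (suc k) zero    (zero  ∷ e) = K.trans (count-0∷ (exponents k 0) e) (coeff-h k 0 e)
  coeff-h (suc k) zero    (suc i ∷ e) = count-0∷-suc (exponents k 0) i e
  coeff-h (suc k) (suc m) (zero  ∷ e) = begin
    count (map (0 ∷_) (exponents k (suc m)) ++ map incr (exponents (suc k) m)) (0 ∷ e)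
      ≈⟨ count-++ (map (0 ∷_) (exponents k (suc m))) _ _ ⟩
    count (map (0 ∷_) (exponents k (suc m))) (0 ∷ e) K.+ count (map incr (exponents (suc k) m)) (0 ∷ e)
      ≈⟨ K.+-cong (count-0∷ (exponents k (suc m)) e) (count-incr-0 (exponents (suc k) m) e) ⟩
    count (exponents k (suc m)) e K.+ K.0#
      ≈⟨ K.trans (K.+-identityʳ _) (coeff-h k (suc m) e) ⟩
    [ degree e ≡? suc m ] ∎
  coeff-h (suc k) (suc m) (suc i ∷ e) = begin
    count (map (0 ∷_) (exponents k (suc m)) ++ map incr (exponents (suc k) m)) (suc i ∷ e)
      ≈⟨ count-++ (map (0 ∷_) (exponents k (suc m))) _ _ ⟩
    count (map (0 ∷_) (exponents k (suc m))) (suc i ∷ e) K.+ count (map incr (exponents (suc k) m)) (suc i ∷ e)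
      ≈⟨ K.+-cong (count-0∷-suc (exponents k (suc m)) i e) (count-incr (exponents (suc k) m) i e) ⟩
    K.0# K.+ count (exponents (suc k) m) (i ∷ e)
      ≈⟨ K.trans (K.+-identityˡ _) (coeff-h (suc k) m (i ∷ e)) ⟩
    [ i ℕ.+ degree e ≡? m ]
      ≈⟨ []-suc (i ℕ.+ degree e) m ⟩
    [ suc i ℕ.+ degree e ≡? suc m ] ∎

  hᵖ-symmetric : ∀ k m → P.IsSymmetric k (hᵖ k m)
  hᵖ-symmetric k m σ = P.mk≈ λ e → begin
    P.coeff k (P.permuteᵖ k σ (hᵖ k m)) e
      ≈⟨ P.eval-permute k σ (hᵖ k m) _ ⟩
    P.eval k (hᵖ k m) (λ f → P.δ k e (permute σ f))
      ≈⟨ P.eval-cong k (hᵖ k m) (λ f → P.δ-transport k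
           (λ σf≡e → ≡.trans (≡.sym (permute-flip′ σ f)) (≡.cong (permute (Perm.flip σ)) σf≡e))
           (λ f≡ → ≡.trans (≡.cong (permute σ) f≡) (permute-flip σ e))) ⟩
    P.coeff k (hᵖ k m) (permute (Perm.flip σ) e)
      ≈⟨ coeff-h k m _ ⟩
    [ degree (permute (Perm.flip σ) e) ≡? m ]
      ≡⟨ ≡.cong [_≡? m ] (degree-permute (Perm.flip σ) e) ⟩
    [ degree e ≡? m ]
      ≈⟨ coeff-h k m e ⟨
    P.coeff k (hᵖ k m) e ∎

------------------------------------------------------------------------
-- Laplace expansion along the first row

module Determinant {c ℓ} (R : CommutativeRing c ℓ) where

  open CommutativeRing R using (Carrier; _*_; -_; 1#; semiring)
  open Algebra.Properties.Semiring.Sum semiring using (sum)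
  open Algebra.Properties.Semiring.Exp semiring using (_^_)

  det : ∀ {m} → (Fin m → Fin m → Carrier) → Carrier
  det {zero}  M = 1#
  det {suc m} M = sum (λ j →
    (- 1#) ^ toℕ j * M zero j * det (λ u v → M (suc u) (punchIn j v)))

------------------------------------------------------------------------

module Quotient {c ℓ} (R : CommutativeRing c ℓ) {m : ℕ}
                (g : Fin m → CommutativeRing.Carrier R) where

  open CommutativeRing R
  open Algebra.Properties.Semiring.Sum semiring
  open Algebra.Properties.Ring ring
  open Relation.Binary.Reasoning.Setoid setoid

  InIdeal : Carrier → Set (c ⊔ ℓ)
  InIdeal x = ∃ λ (r : Fin m → Carrier) → x ≈ sum (λ i → r i * g i)

  InIdeal-≈ : ∀ {x y} → x ≈ y → InIdeal x → InIdeal y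
  InIdeal-≈ x≈y (r , h) = r , trans (sym x≈y) h

  InIdeal-0 : InIdeal 0#
  InIdeal-0 = (λ _ → 0#) , (begin
    0#                        ≈⟨ sum-replicate-zero m ⟨
    sum {m} (λ _ → 0#)        ≈⟨ sum-cong-≋ (λ i → zeroˡ (g i)) ⟨
    sum (λ i → 0# * g i)      ∎)

  InIdeal-+ : ∀ {x y} → InIdeal x → InIdeal y → InIdeal (x + y)
  InIdeal-+ {x} {y} (r , h) (s , i) = (λ j → r j + s j) , (begin
    x + y                                          ≈⟨ +-cong h i ⟩
    sum (λ j → r j * g j) + sum (λ j → s j * g j)  ≈⟨ ∑-distrib-+ (λ j → r j * g j) (λ j → s j * g j) ⟨
    sum (λ j → r j * g j + s j * g j)              ≈⟨ sum-cong-≋ (λ j → distribʳ (g j) (r j) (s j)) ⟨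
    sum (λ j → (r j + s j) * g j)                  ∎)

  InIdeal-* : ∀ z {x} → InIdeal x → InIdeal (z * x)
  InIdeal-* z {x} (r , h) = (λ j → z * r j) , (begin
    z * x                          ≈⟨ *-congˡ h ⟩
    z * sum (λ j → r j * g j)      ≈⟨ *-distribˡ-sum z (λ j → r j * g j) ⟩
    sum (λ j → z * (r j * g j))    ≈⟨ sum-cong-≋ (λ j → *-assoc z (r j) (g j)) ⟨
    sum (λ j → z * r j * g j)      ∎)

  InIdeal-neg : ∀ {x} → InIdeal x → InIdeal (- x)
  InIdeal-neg {x} h = InIdeal-≈ (-1*x≈-x x) (InIdeal-* (- 1#) h)

  infix 4 _∼_

  record _∼_ (x y : Carrier) : Set (c ⊔ ℓ) where
    constructor mk∼
    field difference : InIdeal (x - y)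
  open _∼_ public

  ≈⇒∼ : ∀ {x y} → x ≈ y → x ∼ y
  ≈⇒∼ {x} {y} h = mk∼ (InIdeal-≈ (sym (x≈y⇒x-y≈0 h)) InIdeal-0)
    where
    x≈y⇒x-y≈0 : x ≈ y → x - y ≈ 0#
    x≈y⇒x-y≈0 h = trans (+-congʳ h) (-‿inverseʳ y)

  ∼-sym : ∀ {x y} → x ∼ y → y ∼ x
  ∼-sym {x} {y} (mk∼ h) = mk∼ (InIdeal-≈ (begin
    - (x - y)       ≈⟨ -‿+-comm x (- y) ⟨
    - x + - - y     ≈⟨ +-congˡ (-‿involutive y) ⟩
    - x + y         ≈⟨ +-comm _ _ ⟩
    y - x           ∎) (InIdeal-neg h))

  ∼-trans : ∀ {x y z} → x ∼ y → y ∼ z → x ∼ z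
  ∼-trans {x} {y} {z} (mk∼ h) (mk∼ i) = mk∼ (InIdeal-≈ (begin
    (x - y) + (y - z)     ≈⟨ +-assoc x (- y) (y - z) ⟩
    x + (- y + (y - z))   ≈⟨ +-congˡ (+-assoc (- y) y (- z)) ⟨
    x + ((- y + y) - z)   ≈⟨ +-congˡ (trans (+-congʳ (-‿inverseˡ y)) (+-identityˡ _)) ⟩
    x - z                 ∎) (InIdeal-+ h i))

  ∼-+-cong : ∀ {x x′ y y′} → x ∼ x′ → y ∼ y′ → x + y ∼ x′ + y′
  ∼-+-cong {x} {x′} {y} {y′} (mk∼ h) (mk∼ i) = mk∼ (InIdeal-≈ (begin
    (x - x′) + (y - y′)       ≈⟨ interchange x (- x′) y (- y′) ⟩
    (x + y) + (- x′ + - y′)   ≈⟨ +-congˡ (-‿+-comm x′ y′) ⟩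
    (x + y) - (x′ + y′)       ∎) (InIdeal-+ h i))
    where
    open import Algebra.Properties.CommutativeSemigroup +-commutativeSemigroup using (interchange)

  ∼-*-congˡ : ∀ z {x y} → x ∼ y → z * x ∼ z * y
  ∼-*-congˡ z {x} {y} (mk∼ h) = mk∼ (InIdeal-≈ (begin
    z * (x - y)           ≈⟨ distribˡ z x (- y) ⟩
    z * x + z * - y       ≈⟨ +-congˡ (-‿distribʳ-* z y) ⟨
    z * x - z * y         ∎) (InIdeal-* z h))

  ∼-*-cong : ∀ {x x′ y y′} → x ∼ x′ → y ∼ y′ → x * y ∼ x′ * y′
  ∼-*-cong {x} {x′} {y} {y′} h i =
    ∼-trans (∼-*-congˡ x i)
      (∼-trans (≈⇒∼ (*-comm x y′)) (∼-trans (∼-*-congˡ y′ h) (≈⇒∼ (*-comm y′ x′))))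

  ∼-neg-cong : ∀ {x y} → x ∼ y → - x ∼ - y
  ∼-neg-cong {x} {y} (mk∼ h) = mk∼ (InIdeal-≈ (sym (-‿+-comm x (- y))) (InIdeal-neg h))

  quotientRing : CommutativeRing c (c ⊔ ℓ)
  quotientRing = record
    { Carrier = Carrier ; _≈_ = _∼_ ; _+_ = _+_ ; _*_ = _*_ ; -_ = -_ ; 0# = 0# ; 1# = 1#
    ; isCommutativeRing = record
      { isRing = record
        { +-isAbelianGroup = record
          { isGroup = record
            { isMonoid = record
              { isSemigroup = record
                { isMagma = record
                  { isEquivalence = record { refl = ≈⇒∼ refl ; sym = ∼-sym ; trans = ∼-trans }
                  ; ∙-cong = ∼-+-cong }
                ; assoc = λ x y z → ≈⇒∼ (+-assoc x y z) }
              ; identity = (λ x → ≈⇒∼ (+-identityˡ x)) , (λ x → ≈⇒∼ (+-identityʳ x)) }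
            ; inverse = (λ x → ≈⇒∼ (-‿inverseˡ x)) , (λ x → ≈⇒∼ (-‿inverseʳ x))
            ; ⁻¹-cong = ∼-neg-cong }
          ; comm = λ x y → ≈⇒∼ (+-comm x y) }
        ; *-cong = ∼-*-cong
        ; *-assoc = λ x y z → ≈⇒∼ (*-assoc x y z)
        ; *-identity = (λ x → ≈⇒∼ (*-identityˡ x)) , (λ x → ≈⇒∼ (*-identityʳ x))
        ; distrib = (λ x y z → ≈⇒∼ (distribˡ x y z)) , (λ x y z → ≈⇒∼ (distribʳ x y z)) }
      ; *-comm = λ x y → ≈⇒∼ (*-comm x y) } }

  -- The residue class map; a class is represented by any of its elements.
  residue : Carrier → CommutativeRing.Carrier quotientRing
  residue x = x

------------------------------------------------------------------------

infixl 6 _+ᵛ_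

_+ᵛ_ : ∀ {k} → Vec ℤ k → Vec ℤ k → Vec ℤ k
_+ᵛ_ = zipWith ℤ._+_

∣_∣ᵛ : ∀ {k} → Vec ℤ k → ℤ
∣_∣ᵛ = Vec.foldr _ ℤ._+_ 0ℤ

IsPartition : ∀ {k} → Vec ℕ k → Set
IsPartition = Linked _≥_

zeroOneTuples : ∀ m → List (Vec ℤ m)
zeroOneTuples zero    = [] ∷ []
zeroOneTuples (suc m) = cartesianProductWith _∷_ (0ℤ ∷ 1ℤ ∷ []) (zeroOneTuples m)

-- The elements of V, each listed once (k = 0 is never used).
V : (n k : ℕ) → List (Vec ℤ k)
V n zero    = []
V n (suc k) = map (ℤ.- + n ∷_) (zeroOneTuples k)

------------------------------------------------------------------------
-- Fin k indexes 1,…,k by i ↦ suc (toℕ i).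

module Setup {c ℓ} (𝐤 : CommutativeRing c ℓ) (k n : ℕ)
             (a : Fin k → CommutativeRing.Carrier 𝐤) where

  open Polynomials 𝐤 k public using (symmetricRing; constˢ)

  private module 𝒮 = CommutativeRing symmetricRing

  h : ℤ → 𝒮.Carrier
  h (+ m)    = Complete.hᵖ 𝐤 k m , Complete.hᵖ-symmetric 𝐤 k m
  h -[1+ _ ] = 𝒮.0#

  s : Vec ℤ k → 𝒮.Carrier
  s λs = Determinant.det symmetricRing
    (λ u v → h (lookup λs u ℤ.- + suc (toℕ u) ℤ.+ + suc (toℕ v)))

  -- n - k + j for j = 1,…,k
  n-k+ : Fin k → ℤ
  n-k+ j = + n ℤ.- + k ℤ.+ + suc (toℕ j)

  generator : Fin k → 𝒮.Carrier
  generator j = h (n-k+ j) 𝒮.- constˢ (a j)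

  open Quotient symmetricRing generator public
    renaming (quotientRing to 𝒮/I) using (residue)

  open CommutativeRing 𝒮/I public using (Carrier; _≈_; _+_; _*_; -_; 0#; 1#)
  open Algebra.Properties.Semiring.Sum (CommutativeRing.semiring 𝒮/I) public using (sum-syntax)
  open Algebra.Properties.Semiring.Exp (CommutativeRing.semiring 𝒮/I) public using (_^_)

  -- The sum of F τ over the τ ∈ V with -|τ| = d.
  ∑V : ℤ → (Vec ℤ k → Carrier) → Carrier
  ∑V d F = foldr _+_ 0# (map F (filter (λ τ → ℤ.- ∣ τ ∣ᵛ ℤ.≟ d) (V n k)))

{-# OPTIONS --safe #-}
module Submission where

-- Already in 𝒮 the identity holds with h_{n-k+j} in place of a_j. Write
-- R_q = (h_{q+1}, …, h_{q+k}), so that s_λ = det (R_{λ_u - u})_u, and consider over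
-- 𝐤[x₁,…,x_k][z] the determinant D(q) with first row R_q and further rows
-- R_{q_u} + z R_{q_u+1}, where q_u = μ_u - u. Its coefficient of zⁱ is the sum of the
-- det (R_q ; R_{q_u+τ_u}) over the τ with exactly i ones. As long as q, q_u ≥ -k, the
-- shift R_q ↦ R_{q+1} is a linear map, triangular with diagonal x₁, …, x_k in the basis
-- of columns of complete homogeneous polynomials in fewer and fewer variables, so
--   D(q) + z D(q+1) = ∏ᵢ (1 + z xᵢ) · det (R_q ; R_{q_u}).
-- Let Λ_n send Σᵢ cᵢ zⁱ to Σᵢ (-1)ⁱ h_{n-i} cᵢ. Since Σ hᵢ zⁱ is inverse to ∏ᵢ (1 - z xᵢ),
-- Λ_n kills the right-hand side for n > 0, that is, Λ_{n+1} D(q) = Λ_n D(q+1). Hence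
-- Λ_n D(q) = det (R_{q+n} ; R_{q_u}), and q = μ₁ - n - 1 gives the claim; the condition
-- q ≥ -k is the hypothesis μ₁ > n - k.

open import Defs
open import Algebra.Bundles using (CommutativeRing)
open import Algebra.Morphism.Structures using (module RingMorphisms)
import Algebra.Properties.CommutativeSemigroup
import Algebra.Properties.Ring
import Algebra.Properties.Semiring.Exp
import Algebra.Properties.Semiring.Sum
import Algebra.Solver.Ring.NaturalCoefficients.Default
open import Data.Bool using (Bool; true; false; if_then_else_)
open import Data.Fin using (Fin; zero; suc; toℕ; fromℕ; fromℕ<; inject₁; punchIn)
import Data.Fin.Properties as Finₚ
open import Data.Fin.Subset using (Subset; ∣_∣)
open import Data.Fin.Subset.Properties using (∣p∣≤n)
import Data.Integer as ℤ
open import Data.Integer using (ℤ; +_; -[1+_]; 0ℤ; 1ℤ)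
import Data.Integer.Properties as ℤₚ
import Data.Integer.Solver
open import Data.List as List using (List; foldr; filter)
import Data.List.Properties as Listₚ
import Data.Nat as ℕ
open import Data.Nat using (ℕ; zero; suc; _≡ᵇ_; _∸_; _≤_; _<_; _>_)
import Data.Nat.Properties as ℕₚ
open import Data.Product using (_,_; proj₁)
open import Data.Unit.Polymorphic using (⊤)
open import Data.Vec using (Vec; []; _∷_; lookup; map; tabulate)
import Data.Vec.Functional as Fun
import Data.Vec.Properties as Vecₚ
open import Function using (_∘_; id; mk⇔)
open import Level using (_⊔_)
open import Relation.Binary.PropositionalEquality as ≡ using (_≡_)
import Relation.Binary.Reasoning.Setoid
open import Relation.Nullary using (does)
open import Relation.Nullary.Decidable using (dec-false; does-⇔)
open import Relation.Unary using (Pred; Decidable)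

-- Determinants as alternating multilinear forms in the columns.

module AlternatingForms {c ℓ} (R : CommutativeRing c ℓ) where

  open CommutativeRing R hiding (zero)
  open Algebra.Properties.Ring ring
  open Algebra.Properties.Semiring.Sum semiring
  open Algebra.Properties.Semiring.Exp semiring using (_^_)
  open Algebra.Solver.Ring.NaturalCoefficients.Default commutativeSemiring
  open Relation.Binary.Reasoning.Setoid setoid
  open Determinant R

  Col : ℕ → Set c
  Col m = Fin m → Carrier

  -- The combined column `d` is specified only pointwise, because columns are functions and
  -- pointwise agreement does not make them equal. In this form linearity also yields congruence, as
  -- in `head-cong`.
  HeadLinear : ∀ {m r} → (Vec (Col m) (suc r) → Carrier) → Set (c ⊔ ℓ)
  HeadLinear Δ = ∀ {b c d} α β cs → (∀ u → d u ≈ α * b u + β * c u) →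
                 Δ (d ∷ cs) ≈ α * Δ (b ∷ cs) + β * Δ (c ∷ cs)

  HeadAlternating : ∀ {m r} → (Vec (Col m) (suc r) → Carrier) → Set (c ⊔ ℓ)
  HeadAlternating {r = zero}  Δ = ⊤
  HeadAlternating {r = suc _} Δ = ∀ c cs → Δ (c ∷ c ∷ cs) ≈ 0#

  -- Fixing the leading columns one after another turns the two conditions on the head into
  -- linearity in every column and vanishing at equal adjacent columns. The number `r` of columns is
  -- independent of their height `m`, so forms with some columns already fixed are covered.
  data Alternating {m} : ∀ {r} → (Vec (Col m) r → Carrier) → Set (c ⊔ ℓ) where
    nil  : ∀ {Δ : Vec (Col m) 0 → Carrier} → Alternating Δ
    cons : ∀ {r} {Δ : Vec (Col m) (suc r) → Carrier} → HeadLinear Δ → HeadAlternating Δ →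
           (∀ c → Alternating (λ cs → Δ (c ∷ cs))) → Alternating Δ

  linear : ∀ {m r} {Δ : Vec (Col m) (suc r) → Carrier} → Alternating Δ → HeadLinear Δ
  linear (cons l _ _) = l

  alternating : ∀ {m r} {Δ : Vec (Col m) (suc r) → Carrier} → Alternating Δ → HeadAlternating Δ
  alternating (cons _ a _) = a

  fix-head : ∀ {m r} {Δ : Vec (Col m) (suc r) → Carrier} → Alternating Δ →
             ∀ c → Alternating (λ cs → Δ (c ∷ cs))
  fix-head (cons _ _ t) = t

  head-cong : ∀ {m r} {Δ : Vec (Col m) (suc r) → Carrier} → Alternating Δ →
              ∀ {b d} cs → (∀ u → d u ≈ b u) → Δ (d ∷ cs) ≈ Δ (b ∷ cs)
  head-cong {Δ = Δ} A {b} {d} cs d≈b = trans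
    (linear A {b} {b} {d} 1# 0# cs (λ u → trans (d≈b u) (absorb (b u))))
    (sym (absorb (Δ (b ∷ cs))))
    where
    absorb : ∀ x → x ≈ 1# * x + 0# * x
    absorb x = sym (trans (+-cong (*-identityˡ x) (zeroˡ x)) (+-identityʳ x))

  tabulate-congˡ : ∀ {m r} {Δ : Vec (Col m) r → Carrier} → Alternating Δ →
              {f g : Fin r → Col m} → (∀ v u → f v u ≈ g v u) → Δ (tabulate f) ≈ Δ (tabulate g)
  tabulate-congˡ {r = zero}  A f≈g = refl
  tabulate-congˡ {r = suc r} A {f} {g} f≈g = trans
    (head-cong A (tabulate (f ∘ suc)) (f≈g zero))
    (tabulate-congˡ (fix-head A (g zero)) (f≈g ∘ suc))

  -- Fixing the head of a Laplace expansion leaves a linear combination of two forms; this is what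
  -- `laplace-alternating` needs for its recursive part.
  combination-alternating : ∀ {m r} {Δ Θ : Vec (Col m) r → Carrier} a b →
    Alternating Δ → Alternating Θ → Alternating (λ cs → a * Δ cs + b * Θ cs)
  combination-alternating a b nil nil = nil
  combination-alternating {m} {suc r} {Δ} {Θ} a b A B = cons
    (λ {x} {y} {z} α β cs h → trans
      (+-cong (*-congˡ (linear A α β cs h)) (*-congˡ (linear B α β cs h)))
      (solve 8 (λ a b α β p q r s →
          a :* (α :* p :+ β :* q) :+ b :* (α :* r :+ β :* s)
       := α :* (a :* p :+ b :* r) :+ β :* (a :* q :+ b :* s)) refl
        a b α β (Δ (x ∷ cs)) (Δ (y ∷ cs)) (Θ (x ∷ cs)) (Θ (y ∷ cs))))
    (alt r A B)
    (λ c → combination-alternating a b (fix-head A c) (fix-head B c))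
    where
    alt : ∀ r {Δ Θ : Vec (Col m) (suc r) → Carrier} → Alternating Δ → Alternating Θ →
          HeadAlternating (λ cs → a * Δ cs + b * Θ cs)
    alt zero    A B = _
    alt (suc r) A B c cs = trans
      (+-cong (trans (*-congˡ (alternating A c cs)) (zeroʳ a))
              (trans (*-congˡ (alternating B c cs)) (zeroʳ b)))
      (+-identityˡ 0#)

  delete-row-alternating : ∀ {m r} {Δ : Vec (Col m) r → Carrier} → Alternating Δ →
    Alternating {suc m} (λ cs → Δ (map (_∘ suc) cs))
  delete-row-alternating nil = nil
  delete-row-alternating {m} {suc r} A = cons
    (λ α β cs h → linear A α β (map (_∘ suc) cs) (h ∘ suc))
    (alt r A)
    (λ c → delete-row-alternating (fix-head A (c ∘ suc)))
    where
    alt : ∀ r {Δ : Vec (Col m) (suc r) → Carrier} → Alternating Δ →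
          HeadAlternating {suc m} (λ cs → Δ (map (_∘ suc) cs))
    alt zero    A = _
    alt (suc r) A c cs = alternating A (c ∘ suc) (map (_∘ suc) cs)

  -- Laplace expansion along the first row as a recursion over the columns, so that
  -- no deleted-column indices occur.
  laplace : ∀ {m r} → (Vec (Col m) r → Carrier) → Vec (Col (suc m)) (suc r) → Carrier
  laplace {r = zero}  Δ (c ∷ []) = c zero * Δ []
  laplace {r = suc r} Δ (c ∷ cs) =
    c zero * Δ (map (_∘ suc) cs) + - 1# * laplace (λ ds → Δ (c ∘ suc ∷ ds)) cs

  laplace-combination : ∀ {m r} {Δ Θ Λ : Vec (Col m) r → Carrier} α β →
    (∀ cs → Δ cs ≈ α * Θ cs + β * Λ cs) →
    ∀ cs → laplace Δ cs ≈ α * laplace Θ cs + β * laplace Λ cs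
  laplace-combination {r = zero} {Θ = Θ} {Λ} α β h (c ∷ []) = trans (*-congˡ (h []))
    (solve 5 (λ α β x p q → x :* (α :* p :+ β :* q) := α :* (x :* p) :+ β :* (x :* q)) refl
      α β (c zero) (Θ []) (Λ []))
  laplace-combination {r = suc r} {Θ = Θ} {Λ} α β h (c ∷ cs) = trans
    (+-cong (*-congˡ (h (map (_∘ suc) cs)))
            (*-congˡ (laplace-combination α β (λ ds → h (c ∘ suc ∷ ds)) cs)))
    (solve 8 (λ ε α β x p q r s →
        x :* (α :* p :+ β :* q) :+ ε :* (α :* r :+ β :* s)
     := α :* (x :* p :+ ε :* r) :+ β :* (x :* q :+ ε :* s)) refl
      (- 1#) α β (c zero) (Θ (map (_∘ suc) cs)) (Λ (map (_∘ suc) cs))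
      (laplace (λ ds → Θ (c ∘ suc ∷ ds)) cs) (laplace (λ ds → Λ (c ∘ suc ∷ ds)) cs))

  0*x+0*y≈0 : ∀ {x y} → 0# * x + 0# * y ≈ 0#
  0*x+0*y≈0 = trans (+-cong (zeroˡ _) (zeroˡ _)) (+-identityˡ 0#)

  laplace-zero : ∀ {m r} {Δ : Vec (Col m) r → Carrier} →
    (∀ cs → Δ cs ≈ 0#) → ∀ cs → laplace Δ cs ≈ 0#
  laplace-zero {Δ = Δ} h cs = trans
    (laplace-combination {Θ = Δ} {Δ} 0# 0# (λ cs → trans (h cs) (sym 0*x+0*y≈0)) cs) 0*x+0*y≈0

  -1*-cancel : ∀ x → x + - 1# * x ≈ 0#
  -1*-cancel x = trans (+-congˡ (-1*x≈-x x)) (-‿inverseʳ x)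

  -- Two equal leading columns produce the same product twice with opposite signs. Any further terms
  -- expand a form whose first two columns are equal, so they vanish.
  laplace-alternating : ∀ {m r} {Δ : Vec (Col m) r → Carrier} → Alternating Δ → Alternating (laplace Δ)
  laplace-alternating {r = zero} {Δ} nil = cons
    (λ { {b} {c} α β [] h → trans (*-congʳ (h zero))
         (solve 5 (λ α β x y d → (α :* x :+ β :* y) :* d := α :* (x :* d) :+ β :* (y :* d)) refl
           α β (b zero) (c zero) (Δ [])) })
    _
    (λ c → nil)
  laplace-alternating {m} {suc r} {Δ} A = cons
    (λ {x} {y} {z} α β cs h → trans
      (+-cong (*-congʳ (h zero))
              (*-congˡ (laplace-combination α β (λ ds → linear A α β ds (h ∘ suc)) cs)))
      (solve 8 (λ ε α β x y d p q →
          (α :* x :+ β :* y) :* d :+ ε :* (α :* p :+ β :* q)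
       := α :* (x :* d :+ ε :* p) :+ β :* (y :* d :+ ε :* q)) refl
        (- 1#) α β (x zero) (y zero) (Δ (map (_∘ suc) cs))
        (laplace (λ ds → Δ (x ∘ suc ∷ ds)) cs) (laplace (λ ds → Δ (y ∘ suc ∷ ds)) cs)))
    (alt r A)
    (λ c → combination-alternating (c zero) (- 1#)
      (delete-row-alternating A) (laplace-alternating (fix-head A (c ∘ suc))))
    where
    alt : ∀ r {Δ : Vec (Col m) (suc r) → Carrier} → Alternating Δ → HeadAlternating (laplace Δ)
    alt zero {Δ} A c [] = -1*-cancel _
    alt (suc r) {Δ} A c cs = begin
      x + - 1# * (x + - 1# * laplace (λ es → Δ (c ∘ suc ∷ c ∘ suc ∷ es)) cs)
        ≈⟨ +-congˡ (*-congˡ (trans (+-congˡ (trans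
             (*-congˡ (laplace-zero (alternating A (c ∘ suc)) cs)) (zeroʳ _))) (+-identityʳ x))) ⟩
      x + - 1# * x
        ≈⟨ -1*-cancel x ⟩
      0# ∎
      where x = c zero * Δ (c ∘ suc ∷ map (_∘ suc) cs)

  colDet : ∀ {m} → Vec (Col m) m → Carrier
  colDet {zero}  []  = 1#
  colDet {suc m} cs = laplace colDet cs

  colDet-alternating : ∀ m → Alternating (colDet {m})
  colDet-alternating zero    = nil
  colDet-alternating (suc m) = laplace-alternating (colDet-alternating m)

  -- Every summand after the first carries a factor -1. Pulling it out leaves the same sum for the
  -- form with its first column fixed, which is the recursion of `laplace`.
  sum-minors : ∀ {m} r (Δ : Vec (Col m) r → Carrier) (c : Fin (suc r) → Col (suc m)) →
    sum (λ j → (- 1#) ^ toℕ j * c j zero * Δ (tabulate (λ v → c (punchIn j v) ∘ suc)))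
      ≈ laplace Δ (tabulate c)
  sum-minors zero    Δ c = trans (+-identityʳ _) (*-congʳ (*-identityˡ _))
  sum-minors (suc r) Δ c = +-cong
    (*-cong (*-identityˡ _) (reflexive (≡.cong Δ (Vecₚ.tabulate-∘ (_∘ suc) (c ∘ suc)))))
    (begin
      sum (λ j → (- 1#) * (- 1#) ^ toℕ j * c (suc j) zero * minor j)
        ≈⟨ sum-cong-≋ (λ j → solve 4 (λ ε s x d → ε :* s :* x :* d := ε :* (s :* x :* d)) refl
             (- 1#) ((- 1#) ^ toℕ j) (c (suc j) zero) (minor j)) ⟩
      sum (λ j → (- 1#) * ((- 1#) ^ toℕ j * c (suc j) zero * minor j))
        ≈⟨ *-distribˡ-sum (- 1#) (λ j → (- 1#) ^ toℕ j * c (suc j) zero * minor j) ⟨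
      - 1# * sum (λ j → (- 1#) ^ toℕ j * c (suc j) zero * minor j)
        ≈⟨ *-congˡ (sum-minors r (λ ds → Δ (c zero ∘ suc ∷ ds)) (c ∘ suc)) ⟩
      - 1# * laplace (λ ds → Δ (c zero ∘ suc ∷ ds)) (tabulate (c ∘ suc)) ∎)
    where
    minor : Fin (suc r) → Carrier
    minor j = Δ (c zero ∘ suc ∷ tabulate (λ v → c (suc (punchIn j v)) ∘ suc))

  -- `det` takes a matrix by its rows; `colDet` makes the columns separate arguments, so that column
  -- operations become available.
  det≈colDet : ∀ {m} (M : Fin m → Fin m → Carrier) → det M ≈ colDet (tabulate (λ v u → M u v))
  det≈colDet {zero}  M = refl
  det≈colDet {suc m} M = trans
    (sum-cong-≋ (λ j → *-congˡ {x = (- 1#) ^ toℕ j * M zero j}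
      (det≈colDet (λ u v → M (suc u) (punchIn j v)))))
    (sum-minors m colDet (λ v u → M u v))

  -- Column operations from right to left: each column is replaced while its left neighbour is still
  -- the original one. The multiple of that neighbour contributes a form with two equal adjacent
  -- columns, which vanishes.
  subtract-previous : ∀ {m r} {Δ : Vec (Col m) (suc r) → Carrier} → Alternating Δ →
    (c d : ℕ → Col m) (x : Carrier) → (∀ i u → c (suc i) u ≈ x * c i u + d i u) →
    Δ (c 0 ∷ tabulate (λ v → c (suc (toℕ v)))) ≈ Δ (c 0 ∷ tabulate (λ v → d (toℕ v)))
  subtract-previous {r = zero}  A c d x h = refl
  subtract-previous {r = suc r} {Δ} A c d x h = begin
    Δ (c 0 ∷ c 1 ∷ tabulate (λ v → c (suc (suc (toℕ v)))))
      ≈⟨ subtract-previous (fix-head A (c 0)) (c ∘ suc) (d ∘ suc) x (h ∘ suc) ⟩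
    Δ (c 0 ∷ c 1 ∷ ds)
      ≈⟨ linear (fix-head A (c 0)) x 1# ds (λ u → trans (h 0 u) (+-congˡ (sym (*-identityˡ _)))) ⟩
    x * Δ (c 0 ∷ c 0 ∷ ds) + 1# * Δ (c 0 ∷ d 0 ∷ ds)
      ≈⟨ +-cong (trans (*-congˡ (alternating A (c 0) ds)) (zeroʳ x)) (*-identityˡ _) ⟩
    0# + Δ (c 0 ∷ d 0 ∷ ds)
      ≈⟨ +-identityˡ _ ⟩
    Δ (c 0 ∷ d 0 ∷ ds) ∎
    where ds = tabulate (λ v → d (suc (toℕ v)))

  module ColumnShift {x} {X : Set x} (⟦_⟧ : X → Carrier) (z : Carrier) where

    factor : ∀ {r} → Vec X r → Carrier
    factor []       = 1#
    factor (x ∷ xs) = (1# + z * ⟦ x ⟧) * factor xs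

    -- In the basis of columns G xs 0, G xs′ 1, G xs″ 2, … (xs′, xs″, … the tails of
    -- xs) the shift of columns is triangular, with the variables on its diagonal.
    shift-columns : ∀ {m r} {Δ : Vec (Col m) r → Carrier} → Alternating Δ →
      (G : ∀ {s} → Vec X s → ℕ → Col m) →
      (∀ {s} y (ys : Vec X s) i u → G (y ∷ ys) (suc i) u ≈ ⟦ y ⟧ * G (y ∷ ys) i u + G ys (suc i) u) →
      (∀ u → G [] r u ≈ 0#) → (xs : Vec X r) →
      Δ (tabulate (λ v u → G xs (toℕ v) u + z * G xs (suc (toℕ v)) u))
        ≈ factor xs * Δ (tabulate (λ v → G xs (toℕ v)))
    shift-columns {r = zero} A G step end [] = sym (*-identityˡ _)
    shift-columns {m} {suc r} {Δ} A G step end (x ∷ xs) = begin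
      Δ (N 0 ∷ tabulate (λ v → N (suc (toℕ v))))
        ≈⟨ subtract-previous A N N′ ⟦ x ⟧ N-step ⟩
      Δ (N 0 ∷ tabulate (λ v → N′ (toℕ v)))
        -- With the head fixed, what remains is a shift in the variables `xs`. The family moved on
        -- by one index obeys the same recurrence, and its end condition for `r` columns is the
        -- given one for `suc r`.
        ≈⟨ shift-columns (fix-head A (N 0)) (λ ys i → G ys (suc i)) (λ y ys i → step y ys (suc i)) end xs ⟩
      factor xs * Δ (N 0 ∷ gs)
        ≈⟨ *-congˡ (linear A (1# + z * ⟦ x ⟧) z gs N₀) ⟩
      factor xs * ((1# + z * ⟦ x ⟧) * Δ (G (x ∷ xs) 0 ∷ gs) + z * Δ (G xs 1 ∷ gs))
        -- `G xs 1` is already the first of the columns `gs`, unless `xs` is empty; then the end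
        -- condition makes it zero. Only the diagonal entry 1 + z x survives.
        ≈⟨ *-congˡ (trans (+-congˡ (trans (*-congˡ (repeated xs A end)) (zeroʳ z))) (+-identityʳ _)) ⟩
      factor xs * ((1# + z * ⟦ x ⟧) * Δ (G (x ∷ xs) 0 ∷ gs))
        ≈⟨ solve 3 (λ a b c → a :* (b :* c) := b :* a :* c) refl _ _ _ ⟩
      factor (x ∷ xs) * Δ (G (x ∷ xs) 0 ∷ gs)
        -- The same column operations, read backwards, restore the unshifted columns in all the
        -- variables.
        ≈⟨ *-congˡ (subtract-previous A (G (x ∷ xs)) (λ i → G xs (suc i)) ⟦ x ⟧ (step x xs)) ⟨
      factor (x ∷ xs) * Δ (G (x ∷ xs) 0 ∷ tabulate (λ v → G (x ∷ xs) (suc (toℕ v)))) ∎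
      where
      N N′ : ℕ → Col m
      N  i u = G (x ∷ xs) i u + z * G (x ∷ xs) (suc i) u
      N′ i u = G xs (suc i) u + z * G xs (suc (suc i)) u
      gs = tabulate {n = r} (λ v → G xs (suc (toℕ v)))

      N-step : ∀ i u → N (suc i) u ≈ ⟦ x ⟧ * N i u + N′ i u
      N-step i u = trans (+-cong (step x xs i u) (*-congˡ (step x xs (suc i) u)))
        (solve 6 (λ x z a b a′ b′ → (x :* a :+ a′) :+ z :* (x :* b :+ b′)
                                 := x :* (a :+ z :* b) :+ (a′ :+ z :* b′)) refl
          ⟦ x ⟧ z (G (x ∷ xs) i u) (G (x ∷ xs) (suc i) u) (G xs (suc i) u) (G xs (suc (suc i)) u))

      N₀ : ∀ u → N 0 u ≈ (1# + z * ⟦ x ⟧) * G (x ∷ xs) 0 u + z * G xs 1 u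
      N₀ u = trans (+-congˡ (*-congˡ (step x xs 0 u)))
        (solve 4 (λ x z a b → a :+ z :* (x :* a :+ b) := (con 1 :+ z :* x) :* a :+ z :* b) refl
          ⟦ x ⟧ z (G (x ∷ xs) 0 u) (G xs 1 u))

      repeated : ∀ {r} (xs : Vec X r) {Δ : Vec (Col m) (suc r) → Carrier} → Alternating Δ →
                 (∀ u → G [] (suc r) u ≈ 0#) →
                 Δ (G xs 1 ∷ tabulate (λ v → G xs (suc (toℕ v)))) ≈ 0#
      repeated (_ ∷ _) A end = alternating A _ _
      repeated [] {Δ} A end = trans
        (linear A {G [] 1} {G [] 1} 0# 0# [] (λ u → trans (end u) (sym 0*x+0*y≈0))) 0*x+0*y≈0

    det-shift : ∀ {r} (G : ∀ {s} → Vec X s → ℕ → Col r) →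
      (∀ {s} y (ys : Vec X s) i u → G (y ∷ ys) (suc i) u ≈ ⟦ y ⟧ * G (y ∷ ys) i u + G ys (suc i) u) →
      (∀ u → G [] r u ≈ 0#) → (xs : Vec X r) →
      det (λ u v → G xs (toℕ v) u + z * G xs (suc (toℕ v)) u)
        ≈ factor xs * det (λ u v → G xs (toℕ v) u)
    det-shift {r} G step end xs = begin
      det (λ u v → G xs (toℕ v) u + z * G xs (suc (toℕ v)) u)
        ≈⟨ det≈colDet (λ u v → G xs (toℕ v) u + z * G xs (suc (toℕ v)) u) ⟩
      colDet (tabulate (λ v u → G xs (toℕ v) u + z * G xs (suc (toℕ v)) u))
        ≈⟨ shift-columns (colDet-alternating r) G step end xs ⟩
      factor xs * colDet (tabulate (λ v → G xs (toℕ v)))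
        ≈⟨ *-congˡ (det≈colDet (λ u v → G xs (toℕ v) u)) ⟨
      factor xs * det (λ u v → G xs (toℕ v) u) ∎

-- Expansion of determinants with binomial rows over subsets.

module RowExpansion {c ℓ} (R : CommutativeRing c ℓ) where

  open CommutativeRing R hiding (zero)
  open Algebra.Properties.Semiring.Sum semiring
  open Algebra.Properties.Semiring.Exp semiring using (_^_)
  open Algebra.Properties.CommutativeSemigroup +-commutativeSemigroup using (interchange)
  open Algebra.Properties.CommutativeSemigroup *-commutativeSemigroup using (x∙yz≈y∙xz)
  open Algebra.Solver.Ring.NaturalCoefficients.Default commutativeSemiring
  open Relation.Binary.Reasoning.Setoid setoid
  open Determinant R

  ∑⊆ : ∀ m → (Subset m → Carrier) → Carrier
  ∑⊆ zero    F = F []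
  ∑⊆ (suc m) F = ∑⊆ m (λ b → F (false ∷ b)) + ∑⊆ m (λ b → F (true ∷ b))

  ∑⊆-cong : ∀ m {F G : Subset m → Carrier} → (∀ b → F b ≈ G b) → ∑⊆ m F ≈ ∑⊆ m G
  ∑⊆-cong zero    F≈G = F≈G []
  ∑⊆-cong (suc m) F≈G = +-cong (∑⊆-cong m (λ b → F≈G (false ∷ b))) (∑⊆-cong m (λ b → F≈G (true ∷ b)))

  ∑⊆-distrib-+ : ∀ m (F G : Subset m → Carrier) → ∑⊆ m (λ b → F b + G b) ≈ ∑⊆ m F + ∑⊆ m G
  ∑⊆-distrib-+ zero    F G = refl
  ∑⊆-distrib-+ (suc m) F G = trans
    (+-cong (∑⊆-distrib-+ m (λ b → F (false ∷ b)) (λ b → G (false ∷ b)))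
            (∑⊆-distrib-+ m (λ b → F (true ∷ b)) (λ b → G (true ∷ b))))
    (interchange _ _ _ _)

  *-distribˡ-∑⊆ : ∀ m x (F : Subset m → Carrier) → x * ∑⊆ m F ≈ ∑⊆ m (λ b → x * F b)
  *-distribˡ-∑⊆ zero    x F = refl
  *-distribˡ-∑⊆ (suc m) x F = trans (distribˡ x _ _)
    (+-cong (*-distribˡ-∑⊆ m x (λ b → F (false ∷ b))) (*-distribˡ-∑⊆ m x (λ b → F (true ∷ b))))

  sum-∑⊆ : ∀ {n} m (F : Fin n → Subset m → Carrier) →
           sum (λ j → ∑⊆ m (F j)) ≈ ∑⊆ m (λ b → sum (λ j → F j b))
  sum-∑⊆ zero    F = refl
  sum-∑⊆ (suc m) F = trans
    (∑-distrib-+ (λ j → ∑⊆ m (λ b → F j (false ∷ b))) (λ j → ∑⊆ m (λ b → F j (true ∷ b))))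
    (+-cong (sum-∑⊆ m (λ j b → F j (false ∷ b))) (sum-∑⊆ m (λ j b → F j (true ∷ b))))

  det-cong : ∀ {m} {M N : Fin m → Fin m → Carrier} → (∀ u v → M u v ≈ N u v) → det M ≈ det N
  det-cong {zero}  h = refl
  det-cong {suc m} h = sum-cong-≋ (λ j →
    *-cong (*-congˡ {x = (- 1#) ^ toℕ j} (h zero j)) (det-cong (λ u v → h (suc u) (punchIn j v))))

  det-linear : ∀ {m} z (x y : Fin (suc m) → Carrier) (M : Fin m → Fin (suc m) → Carrier) →
    det ((λ v → x v + z * y v) Fun.∷ M) ≈ det (x Fun.∷ M) + z * det (y Fun.∷ M)
  det-linear {m} z x y M = begin
    sum (λ j → sgn j * (x j + z * y j) * minor j)
      ≈⟨ sum-cong-≋ (λ j → solve 5 (λ s x z y d →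
           s :* (x :+ z :* y) :* d := s :* x :* d :+ z :* (s :* y :* d)) refl
           (sgn j) (x j) z (y j) (minor j)) ⟩
    sum (λ j → sgn j * x j * minor j + z * (sgn j * y j * minor j))
      ≈⟨ ∑-distrib-+ (λ j → sgn j * x j * minor j) (λ j → z * (sgn j * y j * minor j)) ⟩
    sum (λ j → sgn j * x j * minor j) + sum (λ j → z * (sgn j * y j * minor j))
      ≈⟨ +-congˡ (*-distribˡ-sum z (λ j → sgn j * y j * minor j)) ⟨
    sum (λ j → sgn j * x j * minor j) + z * sum (λ j → sgn j * y j * minor j) ∎
    where
    sgn minor : Fin (suc m) → Carrier
    sgn j   = (- 1#) ^ toℕ j
    minor j = det (λ u v → M u (punchIn j v))

  -- Laplace expansion along the intact row `w` leaves minors whose top row is binomial. The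
  -- induction hypothesis treats that top row as its own intact row and expands those below;
  -- linearity in the first row then splits it. Hence linearity in the first row alone suffices.
  det-expand-rows : ∀ m z (w : Fin (suc m) → Carrier) (A : Bool → Fin m → Fin (suc m) → Carrier) →
    det (w Fun.∷ (λ u v → A false u v + z * A true u v))
      ≈ ∑⊆ m (λ b → z ^ ∣ b ∣ * det (w Fun.∷ (λ u → A (lookup b u) u)))
  det-expand-rows zero    z w A = sym (*-identityˡ _)
  det-expand-rows (suc m) z w A = begin
    sum (λ j → s j * det (λ u v → A false u (punchIn j v) + z * A true u (punchIn j v)))
      ≈⟨ sum-cong-≋ (λ j → *-congˡ {x = s j} (minor j)) ⟩
    sum (λ j → s j * ∑⊆ (suc m) (λ b → z ^ ∣ b ∣ * D b j))
      ≈⟨ sum-cong-≋ (λ j → *-distribˡ-∑⊆ (suc m) (s j) (λ b → z ^ ∣ b ∣ * D b j)) ⟩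
    sum (λ j → ∑⊆ (suc m) (λ b → s j * (z ^ ∣ b ∣ * D b j)))
      ≈⟨ sum-∑⊆ (suc m) (λ j b → s j * (z ^ ∣ b ∣ * D b j)) ⟩
    ∑⊆ (suc m) (λ b → sum (λ j → s j * (z ^ ∣ b ∣ * D b j)))
      ≈⟨ ∑⊆-cong (suc m) (λ b → trans
           (sum-cong-≋ (λ j → x∙yz≈y∙xz (s j) (z ^ ∣ b ∣) (D b j)))
           (sym (*-distribˡ-sum (z ^ ∣ b ∣) (λ j → s j * D b j)))) ⟩
    ∑⊆ (suc m) (λ b → z ^ ∣ b ∣ * sum (λ j → s j * D b j)) ∎
    where
    s : Fin (suc (suc m)) → Carrier
    s j = (- 1#) ^ toℕ j * w j

    D : Subset (suc m) → Fin (suc (suc m)) → Carrier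
    D b j = det (λ u v → A (lookup b u) u (punchIn j v))

    minor : ∀ j → det (λ u v → A false u (punchIn j v) + z * A true u (punchIn j v))
                  ≈ ∑⊆ (suc m) (λ b → z ^ ∣ b ∣ * D b j)
    minor j = begin
      det (λ u v → A false u (punchIn j v) + z * A true u (punchIn j v))
        ≡⟨⟩
      det ((λ v → a false v + z * a true v) Fun.∷ (λ u v → A′ false u v + z * A′ true u v))
        ≈⟨ det-expand-rows m z (λ v → a false v + z * a true v) A′ ⟩
      ∑⊆ m (λ b → z ^ ∣ b ∣ * det ((λ v → a false v + z * a true v) Fun.∷ (λ u → A′ (lookup b u) u)))
        ≈⟨ ∑⊆-cong m (λ b → trans
             (*-congˡ (det-linear z (a false) (a true) (λ u → A′ (lookup b u) u)))
             (solve 4 (λ p z x y → p :* (x :+ z :* y) := p :* x :+ z :* p :* y) refl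
               (z ^ ∣ b ∣) z (d b false) (d b true))) ⟩
      ∑⊆ m (λ b → z ^ ∣ b ∣ * d b false + z ^ suc ∣ b ∣ * d b true)
        ≈⟨ ∑⊆-distrib-+ m (λ b → z ^ ∣ b ∣ * d b false) (λ b → z ^ suc ∣ b ∣ * d b true) ⟩
      ∑⊆ m (λ b → z ^ ∣ b ∣ * d b false) + ∑⊆ m (λ b → z ^ suc ∣ b ∣ * d b true)
        ≡⟨⟩
      ∑⊆ (suc m) (λ b → z ^ ∣ b ∣ * D b j) ∎
      where
      a : Bool → Fin (suc m) → Carrier
      a t v = A t zero (punchIn j v)
      A′ : Bool → Fin m → Fin (suc m) → Carrier
      A′ t u v = A t (suc u) (punchIn j v)
      d : Subset m → Bool → Carrier
      d b t = det (a t Fun.∷ (λ u → A′ (lookup b u) u))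

-- Compatibility of ring homomorphisms with sums, signs and determinants.

module Homomorphism {a ℓ₁ b ℓ₂} (R : CommutativeRing a ℓ₁) (S : CommutativeRing b ℓ₂)
  {⟦_⟧ : CommutativeRing.Carrier R → CommutativeRing.Carrier S}
  (hom : RingMorphisms.IsRingHomomorphism (CommutativeRing.rawRing R) (CommutativeRing.rawRing S) ⟦_⟧)
  where

  private
    module R where
      open CommutativeRing R public
      open Algebra.Properties.Semiring.Sum semiring public
      open Algebra.Properties.Semiring.Exp semiring public using (_^_)
      open Determinant R public
    module S where
      open CommutativeRing S public
      open Algebra.Properties.Semiring.Sum semiring public
      open Algebra.Properties.Semiring.Exp semiring public using (_^_)
      open Determinant S public
      open RowExpansion S public
  open RingMorphisms.IsRingHomomorphism hom public

  sum-homo : ∀ {n} (f : Fin n → R.Carrier) → ⟦ R.sum f ⟧ S.≈ S.sum (λ i → ⟦ f i ⟧)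
  sum-homo {zero}  f = 0#-homo
  sum-homo {suc n} f = S.trans (+-homo _ _) (S.+-congˡ (sum-homo (f ∘ suc)))

  -1^-homo : ∀ n → ⟦ (R.- R.1#) R.^ n ⟧ S.≈ (S.- S.1#) S.^ n
  -1^-homo zero    = 1#-homo
  -1^-homo (suc n) = S.trans (*-homo _ _)
    (S.*-cong (S.trans (-‿homo _) (S.-‿cong 1#-homo)) (-1^-homo n))

  det-homo : ∀ {m} (M : Fin m → Fin m → R.Carrier) → ⟦ R.det M ⟧ S.≈ S.det (λ u v → ⟦ M u v ⟧)
  det-homo {zero}  M = 1#-homo
  det-homo {suc m} M = S.trans
    (sum-homo (λ j → (R.- R.1#) R.^ toℕ j R.* M zero j R.* R.det (λ u v → M (suc u) (punchIn j v))))
    (S.sum-cong-≋ (λ j → S.trans (*-homo _ _) (S.*-cong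
      (S.trans (*-homo _ (M zero j)) (S.*-congʳ (-1^-homo (toℕ j))))
      (det-homo (λ u v → M (suc u) (punchIn j v))))))

bit : Bool → ℤ
bit false = 0ℤ
bit true  = 1ℤ

-- Coefficients of polynomials in one variable z.

module Univariate {c ℓ} (R : CommutativeRing c ℓ) where

  open CommutativeRing R hiding (zero)
  open Algebra.Solver.Ring.NaturalCoefficients.Default commutativeSemiring
  open Relation.Binary.Reasoning.Setoid setoid
  open RowExpansion R using (∑⊆)
  open Polynomials R 1 public using (Poly; _+ᵖ_; _*ᵖ_; const; polynomialRing)
  private
    module P = Polynomials R 1
    module R[z] = CommutativeRing polynomialRing
    module S where
      open RowExpansion polynomialRing public using (∑⊆)
      open Algebra.Properties.Semiring.Exp R[z].semiring public using (_^_)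
  open P using (mk≈; coeff≈)

  z : Poly
  z = List.[ 1# , 1 ∷ [] ]

  coefficient : Poly → ℕ → Carrier
  coefficient p i = P.coeff p (i ∷ [])

  coefficient-cong : ∀ {p q} → p R[z].≈ q → ∀ i → coefficient p i ≈ coefficient q i
  coefficient-cong h i = coeff≈ h (i ∷ [])

  coefficient-+ : ∀ p q i → coefficient (p +ᵖ q) i ≈ coefficient p i + coefficient q i
  coefficient-+ p q i = P.eval-+ p q _

  coefficient-const* : ∀ x p i → coefficient (const x *ᵖ p) i ≈ x * coefficient p i
  coefficient-const* x p i = begin
    coefficient (const x *ᵖ p) i
      ≈⟨ P.eval-* (const x) p _ ⟩
    x * P.eval p (λ f → P.δ (i ∷ []) (𝟘 ⊕ f)) + 0#
      ≈⟨ +-identityʳ _ ⟩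
    x * P.eval p (λ f → P.δ (i ∷ []) (𝟘 ⊕ f))
      ≈⟨ *-congˡ (P.eval-cong p (λ f → reflexive (≡.cong (P.δ (i ∷ [])) (⊕-identityˡ f)))) ⟩
    x * coefficient p i ∎

  coefficient-z*-zero : ∀ p → coefficient (z *ᵖ p) 0 ≈ 0#
  coefficient-z*-zero p = begin
    coefficient (z *ᵖ p) 0
      ≈⟨ P.eval-* z p _ ⟩
    1# * P.eval p (λ f → P.δ (0 ∷ []) ((1 ∷ []) ⊕ f)) + 0#
      ≈⟨ trans (+-identityʳ _) (*-identityˡ _) ⟩
    P.eval p (λ f → P.δ (0 ∷ []) ((1 ∷ []) ⊕ f))
      ≈⟨ P.eval-cong p (λ { (j ∷ []) → P.δ-≢ {0 ∷ []} {suc j ∷ []} (λ ()) }) ⟩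
    P.eval p (λ _ → 0#)
      ≈⟨ P.eval-zero p ⟩
    0# ∎

  coefficient-z*-suc : ∀ p i → coefficient (z *ᵖ p) (suc i) ≈ coefficient p i
  coefficient-z*-suc p i = begin
    coefficient (z *ᵖ p) (suc i)
      ≈⟨ P.eval-* z p _ ⟩
    1# * P.eval p (λ f → P.δ (suc i ∷ []) ((1 ∷ []) ⊕ f)) + 0#
      ≈⟨ trans (+-identityʳ _) (*-identityˡ _) ⟩
    P.eval p (λ f → P.δ (suc i ∷ []) ((1 ∷ []) ⊕ f))
      ≈⟨ P.eval-cong p (λ { (j ∷ []) → P.δ-transport {suc i ∷ []} {suc j ∷ []} {i ∷ []} {j ∷ []}
           (λ { ≡.refl → ≡.refl }) (λ { ≡.refl → ≡.refl }) }) ⟩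
    coefficient p i ∎

  coefficient-const-zero : ∀ x → coefficient (const x) 0 ≈ x
  coefficient-const-zero x = trans (+-identityʳ _) (*-identityʳ x)

  coefficient-const-suc : ∀ x i → coefficient (const x) (suc i) ≈ 0#
  coefficient-const-suc x i = trans (+-identityʳ _) (zeroʳ x)

  coefficient-∑⊆ : ∀ m (F : Subset m → Poly) i →
                   coefficient (S.∑⊆ m F) i ≈ ∑⊆ m (λ b → coefficient (F b) i)
  coefficient-∑⊆ zero    F i = refl
  coefficient-∑⊆ (suc m) F i =
    trans (coefficient-+ (S.∑⊆ m (λ b → F (false ∷ b))) (S.∑⊆ m (λ b → F (true ∷ b))) i)
    (+-cong (coefficient-∑⊆ m (λ b → F (false ∷ b)) i) (coefficient-∑⊆ m (λ b → F (true ∷ b)) i))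

  -- The Boolean test `≡ᵇ` removes one successor from both arguments, just as a factor `z` raises
  -- the degree by one, so both sides satisfy the same recursion.
  coefficient-z^*const : ∀ d x i → coefficient ((z S.^ d) *ᵖ const x) i ≈ (if d ≡ᵇ i then x else 0#)
  coefficient-z^*const zero x zero    = trans (coefficient-cong (R[z].*-identityˡ (const x)) 0) (coefficient-const-zero x)
  coefficient-z^*const zero x (suc i) = trans (coefficient-cong (R[z].*-identityˡ (const x)) (suc i)) (coefficient-const-suc x i)
  coefficient-z^*const (suc d) x zero = trans
    (coefficient-cong (R[z].*-assoc z (z S.^ d) (const x)) 0) (coefficient-z*-zero ((z S.^ d) *ᵖ const x))
  coefficient-z^*const (suc d) x (suc i) = trans
    (coefficient-cong (R[z].*-assoc z (z S.^ d) (const x)) (suc i))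
    (trans (coefficient-z*-suc ((z S.^ d) *ᵖ const x) i) (coefficient-z^*const d x i))

  const-isRingHomomorphism : RingMorphisms.IsRingHomomorphism rawRing R[z].rawRing const
  const-isRingHomomorphism = record
    { isSemiringHomomorphism = record
      { isNearSemiringHomomorphism = record
        { +-isMonoidHomomorphism = record
          { isMagmaHomomorphism = record
            { isRelHomomorphism = record { cong = λ x≈y → mk≈ λ m → +-congʳ (*-congʳ x≈y) }
            ; homo = λ x y → mk≈ λ m → trans (+-identityʳ _)
                (trans (distribʳ _ x y) (+-congˡ (sym (+-identityʳ _)))) }
          ; ε-homo = mk≈ λ m → trans (+-identityʳ _) (zeroˡ _) }
        -- In one variable `𝟘 ⊕ 𝟘` computes to `𝟘`, so a product of constants is literally a
        -- constant.
        ; *-homo = λ x y → R[z].refl }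
      ; 1#-homo = R[z].refl }
    ; -‿homo = λ x → R[z].refl }

-- Complete homogeneous polynomials, the functional `Λ` and its value on the determinants D(q).

module CompleteHomogeneous {c ℓ} (R : CommutativeRing c ℓ) where

  open CommutativeRing R hiding (zero)
  open Algebra.Solver.Ring.NaturalCoefficients.Default commutativeSemiring
  open Determinant R
  open RowExpansion R using (∑⊆; ∑⊆-cong)
  open Univariate R
  private
    module R[z] = CommutativeRing polynomialRing
    module S where
      open Algebra.Properties.Semiring.Exp R[z].semiring public using (_^_)
      open Determinant polynomialRing public
      open RowExpansion polynomialRing public
    module Const = Homomorphism R polynomialRing const-isRingHomomorphism
  open AlternatingForms.ColumnShift polynomialRing const z

  -- The complete homogeneous polynomial evaluated at arbitrary ring elements. The recursion
  -- separates the monomials divisible by the first variable from the others.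
  Hℕ : ∀ {r} → Vec Carrier r → ℕ → Carrier
  Hℕ []       zero    = 1#
  Hℕ []       (suc i) = 0#
  Hℕ (x ∷ xs) zero    = Hℕ xs zero
  Hℕ (x ∷ xs) (suc i) = x * Hℕ (x ∷ xs) i + Hℕ xs (suc i)

  H : ∀ {r} → Vec Carrier r → ℤ → Carrier
  H xs (+ i)    = Hℕ xs i
  H xs -[1+ _ ] = 0#

  -- The recursion persists through negative indices. At the step from -1 to 0 it holds because h_0
  -- is the same for both lists of variables.
  H-step : ∀ {r} x (xs : Vec Carrier r) i → H (x ∷ xs) (ℤ.suc i) ≈ x * H (x ∷ xs) i + H xs (ℤ.suc i)
  H-step x xs (+ i)          = refl
  H-step x xs -[1+ zero ]    = sym (trans (+-congʳ (zeroʳ x)) (+-identityˡ _))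
  H-step x xs -[1+ suc i ]   = sym (trans (+-congʳ (zeroʳ x)) (+-identityˡ _))

  -- The coefficient of zⁿ in (Σᵢ hᵢ zⁱ) · (Σᵢ cᵢ (-z)ⁱ).
  Λ : ∀ {r} → Vec Carrier r → ℕ → (ℕ → Carrier) → Carrier
  Λ xs zero    c = Hℕ xs zero * c 0
  Λ xs (suc n) c = Hℕ xs (suc n) * c 0 + - 1# * Λ xs n (c ∘ suc)

  Λ-cong : ∀ {r} (xs : Vec Carrier r) n {c d} → (∀ i → c i ≈ d i) → Λ xs n c ≈ Λ xs n d
  Λ-cong xs zero    h = *-congˡ (h 0)
  Λ-cong xs (suc n) h = +-cong (*-congˡ (h 0)) (*-congˡ (Λ-cong xs n (h ∘ suc)))

  Λ-linear : ∀ {r} (xs : Vec Carrier r) n x c d → Λ xs n (λ i → c i + x * d i) ≈ Λ xs n c + x * Λ xs n d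
  Λ-linear xs zero x c d =
    solve 4 (λ h x c d → h :* (c :+ x :* d) := h :* c :+ x :* (h :* d)) refl (Hℕ xs 0) x (c 0) (d 0)
  Λ-linear xs (suc n) x c d = trans
    (+-congˡ (*-congˡ (Λ-linear xs n x (c ∘ suc) (d ∘ suc))))
    (solve 7 (λ h ε x c d p q → h :* (c :+ x :* d) :+ ε :* (p :+ x :* q)
                             := (h :* c :+ ε :* p) :+ x :* (h :* d :+ ε :* q)) refl
      (Hℕ xs (suc n)) (- 1#) x (c 0) (d 0) (Λ xs n (c ∘ suc)) (Λ xs n (d ∘ suc)))

  Λ-zero : ∀ {r} (xs : Vec Carrier r) n {c} → (∀ i → c i ≈ 0#) → Λ xs n c ≈ 0#
  Λ-zero xs zero    h = trans (*-congˡ (h 0)) (zeroʳ _)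
  Λ-zero xs (suc n) h = trans
    (+-cong (trans (*-congˡ (h 0)) (zeroʳ _)) (trans (*-congˡ (Λ-zero xs n (h ∘ suc))) (zeroʳ _)))
    (+-identityˡ 0#)

  -- The terms of `Λ` inherit the recursion of `Hℕ`. The exception is the last one, which contains
  -- h_0 and is the same for `x ∷ xs` and `xs`.
  Λ-step : ∀ {r} x (xs : Vec Carrier r) n c → Λ (x ∷ xs) (suc n) c ≈ x * Λ (x ∷ xs) n c + Λ xs (suc n) c
  Λ-step x xs zero c =
    solve 6 (λ x h h′ ε c d → (x :* h :+ h′) :* c :+ ε :* (h :* d)
                           := x :* (h :* c) :+ (h′ :* c :+ ε :* (h :* d))) refl
      x (Hℕ xs 0) (Hℕ xs 1) (- 1#) (c 0) (c 1)
  Λ-step x xs (suc n) c = trans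
    (+-congˡ (*-congˡ (Λ-step x xs n (c ∘ suc))))
    (solve 7 (λ x h h′ ε c p q → (x :* h :+ h′) :* c :+ ε :* (x :* p :+ q)
                              := x :* (h :* c :+ ε :* p) :+ (h′ :* c :+ ε :* q)) refl
      x (Hℕ (x ∷ xs) (suc n)) (Hℕ xs (suc (suc n))) (- 1#) (c 0)
      (Λ (x ∷ xs) n (c ∘ suc)) (Λ xs (suc n) (c ∘ suc)))

  -- `Λ` weighs coefficients with powers of -z, so a factor `z` lowers the index by one at the cost
  -- of a sign.
  Λ-z* : ∀ {r} (xs : Vec Carrier r) n p → Λ xs (suc n) (coefficient (z *ᵖ p)) ≈ - 1# * Λ xs n (coefficient p)
  Λ-z* xs n p = trans
    (+-cong (trans (*-congˡ (coefficient-z*-zero p)) (zeroʳ _))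
            (*-congˡ (Λ-cong xs n (coefficient-z*-suc p))))
    (+-identityˡ _)

  Λ-+z* : ∀ {r} (xs : Vec Carrier r) n p q → Λ xs (suc n) (coefficient (p +ᵖ z *ᵖ q))
            ≈ Λ xs (suc n) (coefficient p) + - 1# * Λ xs n (coefficient q)
  Λ-+z* xs n p q = begin
    Λ xs (suc n) (coefficient (p +ᵖ z *ᵖ q))
      ≈⟨ Λ-cong xs (suc n) (λ i → trans (coefficient-+ p (z *ᵖ q) i) (+-congˡ (sym (*-identityˡ _)))) ⟩
    Λ xs (suc n) (λ i → coefficient p i + 1# * coefficient (z *ᵖ q) i)
      ≈⟨ Λ-linear xs (suc n) 1# (coefficient p) (coefficient (z *ᵖ q)) ⟩
    Λ xs (suc n) (coefficient p) + 1# * Λ xs (suc n) (coefficient (z *ᵖ q))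
      ≈⟨ +-congˡ (trans (*-identityˡ _) (Λ-z* xs n q)) ⟩
    Λ xs (suc n) (coefficient p) + - 1# * Λ xs n (coefficient q) ∎
    where open Relation.Binary.Reasoning.Setoid setoid

  -- (Σᵢ hᵢ zⁱ) · ∏ (1 - x z) = 1.
  Λ-factor : ∀ {r} (xs : Vec Carrier r) n p → Λ xs n (coefficient (factor xs *ᵖ p)) ≈ Λ [] n (coefficient p)
  Λ-factor []       n p = Λ-cong [] n (coefficient-cong (R[z].*-identityˡ p))
  Λ-factor (x ∷ xs) n p = trans (cancel n) (Λ-factor xs n p)
    where
    open Relation.Binary.Reasoning.Setoid setoid

    q = factor xs *ᵖ p

    expand : factor (x ∷ xs) *ᵖ p R[z].≈ q +ᵖ z *ᵖ (const x *ᵖ q)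
    expand = Z.solve 4 (λ z x f p → (Z.con 1 Z.:+ z Z.:* x) Z.:* f Z.:* p
                              Z.:= f Z.:* p Z.:+ z Z.:* (x Z.:* (f Z.:* p))) R[z].refl
             z (const x) (factor xs) p
      where module Z = Algebra.Solver.Ring.NaturalCoefficients.Default R[z].commutativeSemiring

    -- One variable is removed at a time. The part z x of the factor contributes -x times the value
    -- of `Λ` at the preceding index, and this cancels the first term of `Λ-step`.
    cancel : ∀ n → Λ (x ∷ xs) n (coefficient (factor (x ∷ xs) *ᵖ p)) ≈ Λ xs n (coefficient q)
    cancel zero = *-congˡ (begin
      coefficient (factor (x ∷ xs) *ᵖ p) 0          ≈⟨ coefficient-cong expand 0 ⟩
      coefficient (q +ᵖ z *ᵖ (const x *ᵖ q)) 0      ≈⟨ coefficient-+ q _ 0 ⟩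
      coefficient q 0 + coefficient (z *ᵖ (const x *ᵖ q)) 0  ≈⟨ +-congˡ (coefficient-z*-zero (const x *ᵖ q)) ⟩
      coefficient q 0 + 0#                          ≈⟨ +-identityʳ _ ⟩
      coefficient q 0                               ∎)
    cancel (suc n) = begin
      Λ (x ∷ xs) (suc n) (coefficient (factor (x ∷ xs) *ᵖ p))
        ≈⟨ Λ-cong (x ∷ xs) (suc n) (coefficient-cong expand) ⟩
      Λ (x ∷ xs) (suc n) (coefficient (q +ᵖ z *ᵖ (const x *ᵖ q)))
        ≈⟨ Λ-+z* (x ∷ xs) n q (const x *ᵖ q) ⟩
      Λ (x ∷ xs) (suc n) (coefficient q) + - 1# * Λ (x ∷ xs) n (coefficient (const x *ᵖ q))
        ≈⟨ +-cong (Λ-step x xs n (coefficient q)) (*-congˡ (begin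
             Λ (x ∷ xs) n (coefficient (const x *ᵖ q))
               ≈⟨ Λ-cong (x ∷ xs) n (λ i → trans (coefficient-const* x q i) (sym (+-identityˡ _))) ⟩
             Λ (x ∷ xs) n (λ i → 0# + x * coefficient q i)
               ≈⟨ Λ-linear (x ∷ xs) n x (λ _ → 0#) (coefficient q) ⟩
             Λ (x ∷ xs) n (λ _ → 0#) + y
               ≈⟨ +-congʳ (Λ-zero (x ∷ xs) n (λ _ → refl)) ⟩
             0# + y
               ≈⟨ +-identityˡ _ ⟩
             y ∎)) ⟩
      y + Λ xs (suc n) (coefficient q) + - 1# * y
        ≈⟨ solve 3 (λ y l y′ → y :+ l :+ y′ := l :+ (y :+ y′)) refl y (Λ xs (suc n) (coefficient q)) (- 1# * y) ⟩
      Λ xs (suc n) (coefficient q) + (y + - 1# * y)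
        ≈⟨ trans (+-congˡ (AlternatingForms.-1*-cancel R y)) (+-identityʳ _) ⟩
      Λ xs (suc n) (coefficient q) ∎
      where y = x * Λ (x ∷ xs) n (coefficient q)

  module _ {m} (xs : Vec Carrier (suc m)) where

    row : ℤ → Fin (suc m) → Carrier
    row q v = H xs (q ℤ.+ + suc (toℕ v))

    module _ (q : Fin m → ℤ) (0≤q : ∀ u → 0ℤ ℤ.≤ q u ℤ.+ + suc m) where

      private
        shifted : Bool → Fin m → Fin (suc m) → Poly
        shifted t u v = const (row (q u ℤ.+ bit t) v)

        D : ℤ → Poly
        D p = S.det ((const ∘ row p) Fun.∷ (λ u v → shifted false u v +ᵖ z *ᵖ shifted true u v))

        E : ℤ → Carrier
        E p = det (row p Fun.∷ (row ∘ q))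

        next : ∀ i j → 1ℤ ℤ.+ i ℤ.+ + suc j ≡ i ℤ.+ + suc (suc j)
        next i j = ≡.trans (≡.cong (ℤ._+ + suc j) (ℤₚ.+-comm 1ℤ i)) (ℤₚ.+-assoc i 1ℤ (+ suc j))

        -- Linearity in the first row merges the two determinants into one in which every row has
        -- the form R_q + z R_{q+1}. Raising the index of a row by one moves its entries by one
        -- column, so this is the column shift of the matrix behind `E p`.
        D-shift : ∀ p → 0ℤ ℤ.≤ p ℤ.+ + suc m →
                  D p +ᵖ z *ᵖ D (ℤ.suc p) R[z].≈ factor xs *ᵖ const (E p)
        D-shift p 0≤p = begin
          D p +ᵖ z *ᵖ D (ℤ.suc p)
            ≈⟨ S.det-linear z (const ∘ row p) (const ∘ row (ℤ.suc p)) (λ u v → shifted false u v +ᵖ z *ᵖ shifted true u v) ⟨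
          S.det ((λ v → const (row p v) +ᵖ z *ᵖ const (row (ℤ.suc p) v))
                 Fun.∷ (λ u v → shifted false u v +ᵖ z *ᵖ shifted true u v))
            ≈⟨ S.det-cong {M = (λ v → const (row p v) +ᵖ z *ᵖ const (row (ℤ.suc p) v))
                 Fun.∷ (λ u v → shifted false u v +ᵖ z *ᵖ shifted true u v)} entries ⟩
          S.det (λ u v → G xs (toℕ v) u +ᵖ z *ᵖ G xs (suc (toℕ v)) u)
            ≈⟨ det-shift G G-step G-end xs ⟩
          factor xs *ᵖ S.det (λ u v → G xs (toℕ v) u)
            ≡⟨⟩
          factor xs *ᵖ S.det (λ u v → const ((row p Fun.∷ (row ∘ q)) u v))
            ≈⟨ R[z].*-congˡ {x = factor xs} (Const.det-homo (row p Fun.∷ (row ∘ q))) ⟨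
          factor xs *ᵖ const (E p) ∎
          where
          open Relation.Binary.Reasoning.Setoid R[z].setoid

          r : Fin (suc m) → ℤ
          r = p Fun.∷ q

          0≤r : ∀ u → 0ℤ ℤ.≤ r u ℤ.+ + suc m
          0≤r zero    = 0≤p
          0≤r (suc u) = 0≤q u

          G : ∀ {s} → Vec Carrier s → ℕ → Fin (suc m) → Poly
          G ys i u = const (H ys (r u ℤ.+ + suc i))

          suc-assoc : ∀ i j → ℤ.suc (i ℤ.+ + suc j) ≡ i ℤ.+ + suc (suc j)
          suc-assoc i j = ≡.trans (≡.sym (ℤₚ.+-assoc 1ℤ i (+ suc j))) (next i j)

          G-step : ∀ {s} y (ys : Vec Carrier s) i u →
                   G (y ∷ ys) (suc i) u R[z].≈ const y *ᵖ G (y ∷ ys) i u +ᵖ G ys (suc i) u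
          G-step y ys i u = R[z].trans
            (Const.⟦⟧-cong (≡.subst (λ j → H (y ∷ ys) j ≈ y * H (y ∷ ys) (r u ℤ.+ + suc i) + H ys j)
                             (suc-assoc (r u) i) (H-step y ys (r u ℤ.+ + suc i))))
            (R[z].trans (Const.+-homo _ _) (R[z].+-congʳ (Const.*-homo y _)))

          -- The lower bounds on `p` and `q` enter here: `r u + suc m` is at least 0, so the entry
          -- just past the last column has positive index, where `H []` vanishes.
          G-end : ∀ u → G [] (suc m) u R[z].≈ R[z].0#
          G-end u = R[z].trans
            (Const.⟦⟧-cong (≡.subst (λ j → H [] j ≈ 0#) (suc-assoc (r u) m) (positive (0≤r u))))
            Const.0#-homo
            where
            positive : ∀ {i} → 0ℤ ℤ.≤ i → H [] (ℤ.suc i) ≈ 0#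
            positive {+ i} _ = refl

          entries : ∀ u v → _ R[z].≈ G xs (toℕ v) u +ᵖ z *ᵖ G xs (suc (toℕ v)) u
          entries zero v = R[z].+-congˡ {x = const (row p v)} (R[z].*-congˡ {x = z}
            (R[z].reflexive (≡.cong (const ∘ H xs) (next p (toℕ v)))))
          entries (suc u) v = R[z].+-cong
            (R[z].reflexive (≡.cong (λ i → const (H xs (i ℤ.+ + suc (toℕ v)))) (ℤₚ.+-identityʳ (q u))))
            (R[z].*-congˡ {x = z} (R[z].reflexive (≡.cong (const ∘ H xs) (ℤₚ.+-assoc (q u) 1ℤ (+ suc (toℕ v))))))

        coefficient-D : ∀ p i → coefficient (D p) i ≈
          ∑⊆ m (λ b → if ∣ b ∣ ≡ᵇ i then det (row p Fun.∷ (λ u → row (q u ℤ.+ bit (lookup b u)))) else 0#)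
        coefficient-D p i = begin
          coefficient (D p) i
            ≈⟨ coefficient-cong (S.det-expand-rows m z (const ∘ row p) shifted) i ⟩
          coefficient (S.∑⊆ m (λ b → (z S.^ ∣ b ∣) *ᵖ S.det ((const ∘ row p) Fun.∷ (λ u → shifted (lookup b u) u)))) i
            ≈⟨ coefficient-∑⊆ m _ i ⟩
          ∑⊆ m (λ b → coefficient ((z S.^ ∣ b ∣) *ᵖ S.det ((const ∘ row p) Fun.∷ (λ u → shifted (lookup b u) u))) i)
            ≈⟨ ∑⊆-cong m (λ b → trans
                 (coefficient-cong (R[z].*-congˡ {x = z S.^ ∣ b ∣} (R[z].sym
                   (Const.det-homo (row p Fun.∷ (λ u → row (q u ℤ.+ bit (lookup b u))))))) i)
                 (coefficient-z^*const ∣ b ∣ _ i)) ⟩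
          ∑⊆ m (λ b → if ∣ b ∣ ≡ᵇ i then det (row p Fun.∷ (λ u → row (q u ℤ.+ bit (lookup b u)))) else 0#) ∎
          where open Relation.Binary.Reasoning.Setoid setoid

        -- Induction on `n` for all `p` at once. Under `Λ` the right-hand side of `D-shift` becomes
        -- `Λ []` of a constant: this is `E p` at index 0 and zero at every positive index, where it
        -- lets one trade the index `suc n` at `p` for `n` at `p + 1`.
        Λ-D : ∀ n p → 0ℤ ℤ.≤ p ℤ.+ + suc m → Λ xs n (coefficient (D p)) ≈ E (p ℤ.+ + n)
        Λ-D zero p 0≤p = begin
          -- At index 0 only the constant coefficient counts, so a multiple of `z` can be added
          -- freely to reach the form of `D-shift`.
          Hℕ xs 0 * coefficient (D p) 0
            ≈⟨ *-congˡ (trans (+-congˡ (coefficient-z*-zero (D (ℤ.suc p)))) (+-identityʳ _)) ⟨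
          Hℕ xs 0 * (coefficient (D p) 0 + coefficient (z *ᵖ D (ℤ.suc p)) 0)
            ≈⟨ *-congˡ (coefficient-+ (D p) (z *ᵖ D (ℤ.suc p)) 0) ⟨
          Λ xs 0 (coefficient (D p +ᵖ z *ᵖ D (ℤ.suc p)))
            ≈⟨ Λ-cong xs 0 (coefficient-cong (D-shift p 0≤p)) ⟩
          Λ xs 0 (coefficient (factor xs *ᵖ const (E p)))
            ≈⟨ Λ-factor xs 0 (const (E p)) ⟩
          1# * coefficient (const (E p)) 0
            ≈⟨ trans (*-identityˡ _) (coefficient-const-zero (E p)) ⟩
          E p
            ≡⟨ ≡.cong E (ℤₚ.+-identityʳ p) ⟨
          E (p ℤ.+ + 0) ∎
          where open Relation.Binary.Reasoning.Setoid setoid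
        Λ-D (suc n) p 0≤p = begin
          Λ xs (suc n) (coefficient (D p))
            ≈⟨ +-identityʳ _ ⟨
          Λ xs (suc n) (coefficient (D p)) + 0#
            ≈⟨ +-congˡ (trans (+-comm _ _) (AlternatingForms.-1*-cancel R y)) ⟨
          Λ xs (suc n) (coefficient (D p)) + (- 1# * y + y)
            ≈⟨ +-assoc _ _ _ ⟨
          Λ xs (suc n) (coefficient (D p)) + - 1# * y + y
            ≈⟨ +-congʳ (Λ-+z* xs n (D p) (D (ℤ.suc p))) ⟨
          Λ xs (suc n) (coefficient (D p +ᵖ z *ᵖ D (ℤ.suc p))) + y
            ≈⟨ +-congʳ (Λ-cong xs (suc n) (coefficient-cong (D-shift p 0≤p))) ⟩
          Λ xs (suc n) (coefficient (factor xs *ᵖ const (E p))) + y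
            ≈⟨ +-congʳ (Λ-factor xs (suc n) (const (E p))) ⟩
          -- Here `Λ []` is unfolded once: h_{n+1} in no variables is 0, and the tail reads only
          -- coefficients of positive degree, which a constant does not have.
          0# * coefficient (const (E p)) 0 + - 1# * Λ [] n (coefficient (const (E p)) ∘ suc) + y
            ≈⟨ +-congʳ (+-cong (zeroˡ _) (trans (*-congˡ (Λ-zero [] n (coefficient-const-suc (E p)))) (zeroʳ _))) ⟩
          0# + 0# + y
            ≈⟨ trans (+-congʳ (+-identityˡ 0#)) (+-identityˡ y) ⟩
          y
            ≈⟨ Λ-D n (ℤ.suc p) (≡.subst (0ℤ ℤ.≤_) (≡.sym (ℤₚ.+-assoc 1ℤ p (+ suc m)))
                 (ℤₚ.≤-trans 0≤p (ℤₚ.i≤suc[i] _))) ⟩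
          E (ℤ.suc p ℤ.+ + n)
            ≡⟨ ≡.cong E (≡.trans (≡.cong (ℤ._+ + n) (ℤₚ.+-comm 1ℤ p)) (ℤₚ.+-assoc p 1ℤ (+ n))) ⟩
          E (p ℤ.+ + suc n) ∎
          where
          open Relation.Binary.Reasoning.Setoid setoid
          y = Λ xs n (coefficient (D (ℤ.suc p)))

      straighten : ∀ n p → 0ℤ ℤ.≤ p ℤ.+ + suc m →
        Λ xs n (λ i → ∑⊆ m (λ b →
          if ∣ b ∣ ≡ᵇ i then det (row p Fun.∷ (λ u → row (q u ℤ.+ bit (lookup b u)))) else 0#))
          ≈ det (row (p ℤ.+ + n) Fun.∷ (row ∘ q))
      straighten n p 0≤p = trans (Λ-cong xs n (λ i → sym (coefficient-D p i))) (Λ-D n p 0≤p)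

-- Sums over V as sums over subsets of prescribed size.

∣map-bit∣ : ∀ {m} (b : Subset m) → ∣ map bit b ∣ᵛ ≡ + ∣ b ∣
∣map-bit∣ []          = ≡.refl
∣map-bit∣ (false ∷ b) = ≡.trans (ℤₚ.+-identityˡ _) (∣map-bit∣ b)
∣map-bit∣ (true ∷ b)  = ≡.cong ℤ.suc (∣map-bit∣ b)

module ListSum {c ℓ} (R : CommutativeRing c ℓ) where

  open CommutativeRing R hiding (zero)
  open RowExpansion R

  ∑ᴸ : ∀ {a} {A : Set a} → (A → Carrier) → List A → Carrier
  ∑ᴸ F xs = foldr _+_ 0# (List.map F xs)

  ∑ᴸ-cong : ∀ {a} {A : Set a} {F G : A → Carrier} → (∀ x → F x ≈ G x) → ∀ xs → ∑ᴸ F xs ≈ ∑ᴸ G xs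
  ∑ᴸ-cong h List.[]       = refl
  ∑ᴸ-cong h (x List.∷ xs) = +-cong (h x) (∑ᴸ-cong h xs)

  ∑ᴸ-map : ∀ {a b} {A : Set a} {B : Set b} (F : B → Carrier) (f : A → B) xs →
           ∑ᴸ F (List.map f xs) ≈ ∑ᴸ (F ∘ f) xs
  ∑ᴸ-map F f xs = reflexive (≡.cong (foldr _+_ 0#) (≡.sym (Listₚ.map-∘ xs)))

  ∑ᴸ-++ : ∀ {a} {A : Set a} (F : A → Carrier) xs ys → ∑ᴸ F (xs List.++ ys) ≈ ∑ᴸ F xs + ∑ᴸ F ys
  ∑ᴸ-++ F List.[]       ys = sym (+-identityˡ _)
  ∑ᴸ-++ F (x List.∷ xs) ys = trans (+-congˡ (∑ᴸ-++ F xs ys)) (sym (+-assoc _ _ _))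

  -- The sum over V for an arbitrary ring. A quotient ring keeps the addition and zero of its ring,
  -- so the same expression also serves modulo an ideal.
  ∑V : ∀ {k} → ℕ → ℤ → (Vec ℤ k → Carrier) → Carrier
  ∑V {k} n d F = ∑ᴸ F (filter (λ τ → ℤ.- ∣ τ ∣ᵛ ℤ.≟ d) (V n k))

  ∑ᴸ-filter : ∀ {a p} {A : Set a} {P : Pred A p} (P? : Decidable P) (F : A → Carrier) xs →
              ∑ᴸ F (filter P? xs) ≈ ∑ᴸ (λ x → if does (P? x) then F x else 0#) xs
  ∑ᴸ-filter P? F List.[] = refl
  ∑ᴸ-filter P? F (x List.∷ xs) with does (P? x)
  ... | true  = +-congˡ (∑ᴸ-filter P? F xs)
  ... | false = trans (∑ᴸ-filter P? F xs) (sym (+-identityˡ _))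

  ∑ᴸ-zeroOneTuples : ∀ m (F : Vec ℤ m → Carrier) → ∑ᴸ F (zeroOneTuples m) ≈ ∑⊆ m (F ∘ map bit)
  ∑ᴸ-zeroOneTuples zero    F = +-identityʳ _
  ∑ᴸ-zeroOneTuples (suc m) F = trans
    (∑ᴸ-++ F (List.map (0ℤ ∷_) (zeroOneTuples m)) (List.map (1ℤ ∷_) (zeroOneTuples m) List.++ List.[]))
    (+-cong (extend 0ℤ) (trans
      (reflexive (≡.cong (∑ᴸ F) (Listₚ.++-identityʳ (List.map (1ℤ ∷_) (zeroOneTuples m))))) (extend 1ℤ)))
    where
    extend : ∀ t → ∑ᴸ F (List.map (t ∷_) (zeroOneTuples m)) ≈ ∑⊆ m (λ b → F (t ∷ map bit b))
    extend t = trans (∑ᴸ-map F (t ∷_) (zeroOneTuples m)) (∑ᴸ-zeroOneTuples m (λ τ → F (t ∷ τ)))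

  ∑⊆-zero : ∀ m {F : Subset m → Carrier} → (∀ b → F b ≈ 0#) → ∑⊆ m F ≈ 0#
  ∑⊆-zero zero    h = h []
  ∑⊆-zero (suc m) h = trans
    (+-cong (∑⊆-zero m (λ b → h (false ∷ b))) (∑⊆-zero m (λ b → h (true ∷ b)))) (+-identityˡ 0#)

  -- For τ with first entry -n, -|τ| is n minus the number of ones. With k = m + 1 and `j` counted
  -- from 0 the prescribed value is n - (m - j), so the condition says that there are m - j ones.
  ∑V-by-size : ∀ m n j (F : Vec ℤ (suc m) → Carrier) → j ≤ m →
    ∑V n (+ n ℤ.- + suc m ℤ.+ + suc j) F
      ≈ ∑⊆ m (λ b → if ∣ b ∣ ≡ᵇ m ∸ j then F (ℤ.- + n ∷ map bit b) else 0#)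
  ∑V-by-size m n j F j≤m = trans
    (trans (∑ᴸ-filter P? F (V n (suc m)))
      (trans (∑ᴸ-map _ (ℤ.- + n ∷_) (zeroOneTuples m)) (∑ᴸ-zeroOneTuples m _)))
    (∑⊆-cong m (λ b → reflexive (≡.cong (if_then F (ℤ.- + n ∷ map bit b) else 0#)
      (does-⇔ (mk⇔ (to b) (from b)) (P? (ℤ.- + n ∷ map bit b)) (∣ b ∣ ℕ.≟ m ∸ j)))))
    where
    open Data.Integer.Solver.+-*-Solver
    open Algebra.Properties.Ring ℤₚ.+-*-ring using (+-cancelˡ)
    P? = λ (τ : Vec ℤ (suc m)) → ℤ.- ∣ τ ∣ᵛ ℤ.≟ + n ℤ.- + suc m ℤ.+ + suc j

    weight : ∀ b → ℤ.- (ℤ.- + n ℤ.+ ∣ map bit b ∣ᵛ) ≡ + n ℤ.- + ∣ b ∣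
    weight b = ≡.trans (≡.cong (λ w → ℤ.- (ℤ.- + n ℤ.+ w)) (∣map-bit∣ b))
      (solve 2 (λ n w → :- (:- n :+ w) := n :- w) ≡.refl (+ n) (+ ∣ b ∣))

    target : + n ℤ.- + suc m ℤ.+ + suc j ≡ + n ℤ.- + (m ∸ j)
    target = ≡.trans
      (≡.cong (λ i → + n ℤ.- + suc i ℤ.+ + suc j) (≡.sym (ℕₚ.m∸n+n≡m j≤m)))
      (solve 3 (λ n i j → n :- (con 1ℤ :+ (i :+ j)) :+ (con 1ℤ :+ j) := n :- i) ≡.refl (+ n) (+ (m ∸ j)) (+ j))

    to : ∀ b → ℤ.- (ℤ.- + n ℤ.+ ∣ map bit b ∣ᵛ) ≡ + n ℤ.- + suc m ℤ.+ + suc j → ∣ b ∣ ≡ m ∸ j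
    to b h = ℤₚ.+-injective (ℤₚ.neg-injective (+-cancelˡ (+ n) _ _
      (≡.trans (≡.sym (weight b)) (≡.trans h target))))

    from : ∀ b → ∣ b ∣ ≡ m ∸ j → ℤ.- (ℤ.- + n ℤ.+ ∣ map bit b ∣ᵛ) ≡ + n ℤ.- + suc m ℤ.+ + suc j
    from b h = ≡.trans (weight b) (≡.trans (≡.cong (λ i → + n ℤ.- + i) h) (≡.sym target))

-- The straightening identity with h_{n-k+j} in place of a_j.

0≤a-x+y : ∀ a x y → x ≤ a ℕ.+ y → 0ℤ ℤ.≤ + a ℤ.- + x ℤ.+ + y
0≤a-x+y a x y x≤a+y = ≡.subst (0ℤ ℤ.≤_)
  (Z.solve 3 (λ a x y → a Z.:+ y Z.:- x Z.:= a Z.:- x Z.:+ y) ≡.refl (+ a) (+ x) (+ y))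
  (ℤₚ.i≤j⇒0≤j-i (ℤ.+≤+ x≤a+y))
  where module Z = Data.Integer.Solver.+-*-Solver

module Straightening {c ℓ} (R : CommutativeRing c ℓ) where

  open CommutativeRing R hiding (zero)
  open Algebra.Properties.Semiring.Sum semiring
  open Algebra.Properties.Semiring.Exp semiring using (_^_)
  open Algebra.Solver.Ring.NaturalCoefficients.Default commutativeSemiring
  open Relation.Binary.Reasoning.Setoid setoid
  open Determinant R
  open RowExpansion R
  open CompleteHomogeneous R
  open ListSum R

  -- `Λ` lists its terms from the highest h downwards, the sum upwards, so the induction splits off
  -- the last summand. The vanishing of `c` from `k` on discards the terms of `Λ` with h of index at
  -- most `d`.
  Λ-as-sum : ∀ {r} (xs : Vec Carrier r) k d c → (∀ i → c (k ℕ.+ i) ≈ 0#) →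
    sum {k} (λ j → (- 1#) ^ (k ∸ suc (toℕ j)) * Hℕ xs (d ℕ.+ suc (toℕ j)) * c (k ∸ suc (toℕ j)))
      ≈ Λ xs (d ℕ.+ k) c
  Λ-as-sum xs zero    d c h = sym (Λ-zero xs (d ℕ.+ 0) h)
  Λ-as-sum xs (suc k) d c h = begin
    sum {suc k} (λ j → t (toℕ j))
      ≈⟨ sum-init-last {k} (λ j → t (toℕ j)) ⟩
    sum {k} (λ j → t (toℕ (inject₁ j))) + t (toℕ (fromℕ k))
      ≈⟨ +-cong (sum-cong-≋ {k} earlier) final ⟩
    sum {k} (λ j → - 1# * t′ j) + Hℕ xs (d ℕ.+ suc k) * c 0
      ≈⟨ +-congʳ (*-distribˡ-sum (- 1#) t′) ⟨
    - 1# * sum t′ + Hℕ xs (d ℕ.+ suc k) * c 0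
      ≈⟨ +-comm _ _ ⟩
    Hℕ xs (d ℕ.+ suc k) * c 0 + - 1# * sum t′
      ≈⟨ +-cong (*-congʳ (reflexive (≡.cong (Hℕ xs) (ℕₚ.+-suc d k))))
                (*-congˡ (Λ-as-sum xs k d (c ∘ suc) h)) ⟩
    Λ xs (suc (d ℕ.+ k)) c
      ≡⟨ ≡.cong (λ i → Λ xs i c) (ℕₚ.+-suc d k) ⟨
    Λ xs (d ℕ.+ suc k) c ∎
    where
    t : ℕ → Carrier
    t i = (- 1#) ^ (k ∸ i) * Hℕ xs (d ℕ.+ suc i) * c (k ∸ i)

    t′ : Fin k → Carrier
    t′ j = (- 1#) ^ (k ∸ suc (toℕ j)) * Hℕ xs (d ℕ.+ suc (toℕ j)) * c (suc (k ∸ suc (toℕ j)))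

    earlier : ∀ j → t (toℕ (inject₁ j)) ≈ - 1# * t′ j
    earlier j = begin
      t (toℕ (inject₁ j))
        ≡⟨ ≡.cong t (Finₚ.toℕ-inject₁ j) ⟩
      t (toℕ j)
        ≡⟨ ≡.cong (λ i → (- 1#) ^ i * Hℕ xs (d ℕ.+ suc (toℕ j)) * c i) (ℕₚ.+-∸-assoc 1 (Finₚ.toℕ<n j)) ⟩
      (- 1#) ^ suc (k ∸ suc (toℕ j)) * Hℕ xs (d ℕ.+ suc (toℕ j)) * c (suc (k ∸ suc (toℕ j)))
        ≈⟨ solve 4 (λ ε s x y → ε :* s :* x :* y := ε :* (s :* x :* y)) refl
             (- 1#) ((- 1#) ^ (k ∸ suc (toℕ j))) (Hℕ xs (d ℕ.+ suc (toℕ j))) (c (suc (k ∸ suc (toℕ j)))) ⟩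
      - 1# * t′ j ∎

    final : t (toℕ (fromℕ k)) ≈ Hℕ xs (d ℕ.+ suc k) * c 0
    final = begin
      t (toℕ (fromℕ k))
        ≡⟨ ≡.cong t (Finₚ.toℕ-fromℕ k) ⟩
      (- 1#) ^ (k ∸ k) * Hℕ xs (d ℕ.+ suc k) * c (k ∸ k)
        ≡⟨ ≡.cong (λ i → (- 1#) ^ i * Hℕ xs (d ℕ.+ suc k) * c i) (ℕₚ.n∸n≡0 k) ⟩
      1# * Hℕ xs (d ℕ.+ suc k) * c 0
        ≈⟨ *-congʳ (*-identityˡ _) ⟩
      Hℕ xs (d ℕ.+ suc k) * c 0 ∎

  jacobiTrudi : ∀ {r} → Vec Carrier r → Vec ℤ r → Fin r → Fin r → Carrier
  jacobiTrudi xs λs u v = H xs (lookup λs u ℤ.- + suc (toℕ u) ℤ.+ + suc (toℕ v))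

  schur : ∀ {r} → Vec Carrier r → Vec ℤ r → Carrier
  schur xs λs = det (jacobiTrudi xs λs)

  schur-straighten : ∀ {m} (xs : Vec Carrier (suc m)) n (λs : Vec ℤ (suc m)) → suc m ≤ n →
    0ℤ ℤ.≤ lookup λs zero ℤ.- + suc n ℤ.+ + suc m →
    (∀ u → 0ℤ ℤ.≤ lookup λs (suc u) ℤ.- + suc (suc (toℕ u)) ℤ.+ + suc m) →
    schur xs λs ≈ sum {suc m} (λ j →
      (- 1#) ^ (suc m ∸ suc (toℕ j)) * H xs (+ n ℤ.- + suc m ℤ.+ + suc (toℕ j)) *
      ∑V n (+ n ℤ.- + suc m ℤ.+ + suc (toℕ j)) (λ τ → schur xs (λs +ᵛ τ)))
  schur-straighten {m} xs n (l ∷ ls) m<n 0≤p 0≤q = begin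
    schur xs (l ∷ ls)
      ≈⟨ det-cong {M = row xs (p ℤ.+ + n) Fun.∷ (λ u → row xs (q u))} {jacobiTrudi xs (l ∷ ls)} (λ
           { zero v → H-≡ (≡.cong (ℤ._+ + suc (toℕ v)) (last-row l)) ; (suc u) v → refl }) ⟨
    det (row xs (p ℤ.+ + n) Fun.∷ (λ u → row xs (q u)))
      ≈⟨ straighten xs q 0≤q n p 0≤p ⟨
    Λ xs n (λ i → ∑⊆ m (λ b → if ∣ b ∣ ≡ᵇ i then shifted b else 0#))
      ≈⟨ Λ-cong xs n (λ i → ∑⊆-cong m (λ b → if-cong (∣ b ∣ ≡ᵇ i) (shifted≈F b))) ⟩
    Λ xs n C
      -- The index n is split as (n - k) + k, so that the k surviving terms carry h_{n-k+1} up to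
      -- h_n.
      ≡⟨ ≡.cong (λ i → Λ xs i C) (ℕₚ.m∸n+n≡m m<n) ⟨
    Λ xs (n ∸ suc m ℕ.+ suc m) C
      ≈⟨ Λ-as-sum xs (suc m) (n ∸ suc m) C beyond ⟨
    sum {suc m} (λ j → (- 1#) ^ (m ∸ toℕ j) * Hℕ xs (n ∸ suc m ℕ.+ suc (toℕ j)) * C (m ∸ toℕ j))
      ≈⟨ sum-cong-≋ {suc m} (λ j → *-cong
           (*-congˡ {x = (- 1#) ^ (m ∸ toℕ j)} (H-≡ (index j)))
           (sym (∑V-by-size m n (toℕ j) F (ℕₚ.≤-pred (Finₚ.toℕ<n j))))) ⟩
    sum {suc m} (λ j →
      (- 1#) ^ (suc m ∸ suc (toℕ j)) * H xs (+ n ℤ.- + suc m ℤ.+ + suc (toℕ j)) *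
      ∑V n (+ n ℤ.- + suc m ℤ.+ + suc (toℕ j)) F) ∎
    where
    module Z = Data.Integer.Solver.+-*-Solver
    open Z using () renaming (_:+_ to _⊞_; _:-_ to _⊟_; :-_ to ⊟_; _:=_ to _≜_)

    p : ℤ
    -- This is the index of the first row after adding τ, whose first entry is -n. Since p + n = l -
    -- 1, it is also the value that makes `straighten` end at the original first row.
    p = l ℤ.- + suc n
    q : Fin m → ℤ
    q u = lookup ls u ℤ.- + suc (suc (toℕ u))

    F : Vec ℤ (suc m) → Carrier
    F τ = schur xs ((l ∷ ls) +ᵛ τ)

    C : ℕ → Carrier
    C i = ∑⊆ m (λ b → if ∣ b ∣ ≡ᵇ i then F (ℤ.- + n ∷ map bit b) else 0#)

    shifted : Subset m → Carrier
    shifted b = det (row xs p Fun.∷ (λ u → row xs (q u ℤ.+ bit (lookup b u))))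

    H-≡ : ∀ {i j} → i ≡ j → H xs i ≈ H xs j
    H-≡ i≡j = reflexive (≡.cong (H xs) i≡j)

    if-cong : ∀ t {x y} → x ≈ y → (if t then x else 0#) ≈ (if t then y else 0#)
    if-cong true  x≈y = x≈y
    if-cong false x≈y = refl

    last-row : ∀ l → l ℤ.- + suc n ℤ.+ + n ≡ l ℤ.- 1ℤ
    last-row l = Z.solve 2 (λ l n → l ⊟ (Z.con 1ℤ ⊞ n) ⊞ n ≜ l ⊟ Z.con 1ℤ) ≡.refl l (+ n)

    shifted≈F : ∀ b → shifted b ≈ F (ℤ.- + n ∷ map bit b)
    shifted≈F b = det-cong {M = row xs p Fun.∷ (λ u → row xs (q u ℤ.+ bit (lookup b u)))}
      {jacobiTrudi xs ((l ∷ ls) +ᵛ (ℤ.- + n ∷ map bit b))} (λ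
      { zero v → H-≡ (≡.cong (ℤ._+ + suc (toℕ v))
          (Z.solve 2 (λ l n → l ⊟ (Z.con 1ℤ ⊞ n) ≜ l ⊞ (⊟ n) ⊟ Z.con 1ℤ) ≡.refl l (+ n)))
      ; (suc u) v → H-≡ (≡.cong (ℤ._+ + suc (toℕ v)) (row-entry u))
      })
      where
      row-entry : ∀ u → q u ℤ.+ bit (lookup b u)
                   ≡ lookup (ls +ᵛ map bit b) u ℤ.- + suc (suc (toℕ u))
      row-entry u = ≡.trans
        (Z.solve 3 (λ x y z → x ⊟ y ⊞ z ≜ x ⊞ z ⊟ y) ≡.refl (lookup ls u) (+ suc (suc (toℕ u))) (bit (lookup b u)))
        (≡.cong (ℤ._- + suc (suc (toℕ u))) (≡.sym (≡.trans
          (Vecₚ.lookup-zipWith ℤ._+_ u ls (map bit b))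
          (≡.cong (λ t → lookup ls u ℤ.+ t) (Vecₚ.lookup-map u bit b)))))

    -- Subsets of an m-element set have at most m elements, so no subset is counted here.
    beyond : ∀ i → C (suc m ℕ.+ i) ≈ 0#
    beyond i = ∑⊆-zero m (λ b → reflexive (≡.cong (if_then F (ℤ.- + n ∷ map bit b) else 0#)
      (dec-false (∣ b ∣ ℕ.≟ suc m ℕ.+ i) (ℕₚ.<⇒≢ (ℕₚ.≤-trans (ℕ.s≤s (∣p∣≤n b)) (ℕₚ.m≤m+n (suc m) i))))))

    index : ∀ (j : Fin (suc m)) → + (n ∸ suc m ℕ.+ suc (toℕ j)) ≡ + n ℤ.- + suc m ℤ.+ + suc (toℕ j)
    index j = ≡.cong (ℤ._+ + suc (toℕ j)) (≡.trans
      (≡.sym (ℤₚ.⊖-≥ m<n)) (≡.sym (ℤₚ.m-n≡m⊖n n (suc m))))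

  -- The hypothesis on the first entry says μ₁ + k ≥ n + 1, which is the bound p ≥ -k for the first
  -- row. The other rows satisfy theirs because the entries of `μ` are natural numbers and the row
  -- number is at most k.
  schur-straighten-ℕ : ∀ {k} (xs : Vec Carrier k) n (k>0 : k > 0) → k ≤ n →
    (μ : Vec ℕ k) → lookup μ (fromℕ< k>0) > n ∸ k →
    schur xs (map +_ μ) ≈ sum {k} (λ j →
      (- 1#) ^ (k ∸ suc (toℕ j)) * H xs (+ n ℤ.- + k ℤ.+ + suc (toℕ j)) *
      ∑V n (+ n ℤ.- + k ℤ.+ + suc (toℕ j)) (λ τ → schur xs (map +_ μ +ᵛ τ)))
  schur-straighten-ℕ {suc m} xs n k>0 k≤n (μ₁ ∷ μs) μ₁>n∸k =
    schur-straighten xs n (map +_ (μ₁ ∷ μs)) k≤n (0≤a-x+y μ₁ (suc n) (suc m) n<μ₁+k) 0≤q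
    where
    n<μ₁+k : n < μ₁ ℕ.+ suc m
    n<μ₁+k = ≡.subst (λ i → suc i ≤ μ₁ ℕ.+ suc m) (ℕₚ.m∸n+n≡m k≤n) (ℕₚ.+-monoˡ-≤ (suc m) μ₁>n∸k)

    0≤q : ∀ u → 0ℤ ℤ.≤ lookup (map +_ μs) u ℤ.- + suc (suc (toℕ u)) ℤ.+ + suc m
    0≤q u = ≡.subst (λ i → 0ℤ ℤ.≤ i ℤ.- + suc (suc (toℕ u)) ℤ.+ + suc m)
      (≡.sym (Vecₚ.lookup-map u +_ μs))
      (0≤a-x+y (lookup μs u) (suc (suc (toℕ u))) (suc m)
        (ℕₚ.≤-trans (ℕ.s≤s (Finₚ.toℕ<n u)) (ℕₚ.m≤n+m (suc m) (lookup μs u))))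

-- Generators of an ideal and the residue map.

module _ {c ℓ} (R : CommutativeRing c ℓ) where

  open CommutativeRing R hiding (zero)
  open Algebra.Properties.Semiring.Sum semiring

  generator∈ideal : ∀ {m} (g : Fin m → Carrier) j → Quotient.InIdeal R g (g j)
  generator∈ideal {suc m} g zero = (1# Fun.∷ (λ _ → 0#)) , sym (trans
    (+-cong (*-identityˡ _) (trans (sum-cong-≋ {m} (λ i → zeroˡ (g (suc i)))) (sum-replicate-zero m)))
    (+-identityʳ _))
  generator∈ideal {suc m} g (suc j) with generator∈ideal (g ∘ suc) j
  ... | r , eq = (0# Fun.∷ r) , trans eq (sym (trans (+-congʳ (zeroˡ _)) (+-identityˡ _)))

module _ {c ℓ} (R : CommutativeRing c ℓ) {m : ℕ} (g : Fin m → CommutativeRing.Carrier R) where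

  open Quotient R g using (≈⇒∼; quotientRing; residue)
  private module R/I = CommutativeRing quotientRing

  residue-isRingHomomorphism :
    RingMorphisms.IsRingHomomorphism (CommutativeRing.rawRing R) R/I.rawRing residue
  residue-isRingHomomorphism = record
    { isSemiringHomomorphism = record
      { isNearSemiringHomomorphism = record
        { +-isMonoidHomomorphism = record
          { isMagmaHomomorphism = record
            { isRelHomomorphism = record { cong = ≈⇒∼ }
            ; homo = λ x y → R/I.refl }
          ; ε-homo = R/I.refl }
        ; *-homo = λ x y → R/I.refl }
      ; 1#-homo = R/I.refl }
    ; -‿homo = λ x → R/I.refl }

-- Transfer of the identity to a subring and reduction modulo the ideal.

module StraighteningInSubring {a ℓ₁ b ℓ₂} (R : CommutativeRing a ℓ₁) (S : CommutativeRing b ℓ₂)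
  {⟦_⟧ : CommutativeRing.Carrier R → CommutativeRing.Carrier S}
  (mono : RingMorphisms.IsRingMonomorphism (CommutativeRing.rawRing R) (CommutativeRing.rawRing S) ⟦_⟧)
  where

  private
    module R where
      open CommutativeRing R public
      open Algebra.Properties.Semiring.Sum semiring public
      open Algebra.Properties.Semiring.Exp semiring public using (_^_)
      open Determinant R public
      open ListSum R public
    module S where
      open CommutativeRing S public
      open Algebra.Properties.Semiring.Sum semiring public
      open Algebra.Properties.Semiring.Exp semiring public using (_^_)
      open RowExpansion S public
      open CompleteHomogeneous S public
      open Straightening S public
      open ListSum S public
  open RingMorphisms.IsRingMonomorphism mono using (injective; isRingHomomorphism)
  open Homomorphism R S isRingHomomorphism
  open Relation.Binary.Reasoning.Setoid S.setoid

  ∑ᴸ-homo : ∀ {x} {X : Set x} (F : X → R.Carrier) ys → ⟦ R.∑ᴸ F ys ⟧ S.≈ S.∑ᴸ (λ y → ⟦ F y ⟧) ys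
  ∑ᴸ-homo F List.[]       = 0#-homo
  ∑ᴸ-homo F (y List.∷ ys) = S.trans (+-homo _ _) (S.+-congˡ (∑ᴸ-homo F ys))

  module _ {k} (xs : Vec S.Carrier k) (h : ℤ → R.Carrier) (h≈H : ∀ i → ⟦ h i ⟧ S.≈ S.H xs i) where

    s : Vec ℤ k → R.Carrier
    s λs = R.det (λ u v → h (lookup λs u ℤ.- + suc (toℕ u) ℤ.+ + suc (toℕ v)))

    s≈schur : ∀ λs → ⟦ s λs ⟧ S.≈ S.schur xs λs
    s≈schur λs = S.trans
      (det-homo (λ u v → h (lookup λs u ℤ.- + suc (toℕ u) ℤ.+ + suc (toℕ v))))
      (S.det-cong {M = λ u v → ⟦ h (lookup λs u ℤ.- + suc (toℕ u) ℤ.+ + suc (toℕ v)) ⟧} {S.jacobiTrudi xs λs}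
        (λ u v → h≈H (lookup λs u ℤ.- + suc (toℕ u) ℤ.+ + suc (toℕ v))))

    -- The elements `xs` live in the larger ring `S` only, so the identity is proved there. Both
    -- sides are built from the `h i` by ring operations, hence come from `R`, and injectivity
    -- brings the equality back.
    s-straighten : ∀ n (k>0 : k > 0) → k ≤ n → (μ : Vec ℕ k) → lookup μ (fromℕ< k>0) > n ∸ k →
      s (map +_ μ) R.≈ R.sum {k} (λ j →
        (R.- R.1#) R.^ (k ∸ suc (toℕ j)) R.* h (+ n ℤ.- + k ℤ.+ + suc (toℕ j)) R.*
        R.∑V n (+ n ℤ.- + k ℤ.+ + suc (toℕ j)) (λ τ → s (map +_ μ +ᵛ τ)))
    s-straighten n k>0 k≤n μ μ₁>n∸k = injective (begin
      ⟦ s λs ⟧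
        ≈⟨ s≈schur λs ⟩
      S.schur xs λs
        ≈⟨ S.schur-straighten-ℕ xs n k>0 k≤n μ μ₁>n∸k ⟩
      S.sum {k} (λ j → (S.- S.1#) S.^ (k ∸ suc (toℕ j)) S.* S.H xs (i j)
                       S.* S.∑V n (i j) (λ τ → S.schur xs (λs +ᵛ τ)))
        ≈⟨ S.sum-cong-≋ {k} (λ j → S.trans (*-homo _ _) (S.*-cong
             (S.trans (*-homo _ _) (S.*-cong (-1^-homo (k ∸ suc (toℕ j))) (h≈H (i j))))
             (S.trans (∑ᴸ-homo (λ τ → s (λs +ᵛ τ)) (τs j)) (S.∑ᴸ-cong (λ τ → s≈schur (λs +ᵛ τ)) (τs j))))) ⟨
      S.sum {k} (λ j → ⟦ term j ⟧)
        ≈⟨ sum-homo term ⟨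
      ⟦ R.sum term ⟧ ∎)
      where
      λs : Vec ℤ k
      λs = map +_ μ

      i : Fin k → ℤ
      i j = + n ℤ.- + k ℤ.+ + suc (toℕ j)

      τs : Fin k → List (Vec ℤ k)
      τs j = filter (λ τ → ℤ.- ∣ τ ∣ᵛ ℤ.≟ i j) (V n k)

      term : Fin k → R.Carrier
      term j = (R.- R.1#) R.^ (k ∸ suc (toℕ j)) R.* h (i j) R.* R.∑V n (i j) (λ τ → s (λs +ᵛ τ))

    module _ (n : ℕ) (a : Fin k → R.Carrier) where

      generator : Fin k → R.Carrier
      generator j = h (+ n ℤ.- + k ℤ.+ + suc (toℕ j)) R.- a j

      private
        module Q where
          open CommutativeRing (Quotient.quotientRing R generator) public
          open Algebra.Properties.Semiring.Sum semiring public
          open Algebra.Properties.Semiring.Exp semiring public using (_^_)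
        module Residue = Homomorphism R (Quotient.quotientRing R generator) (residue-isRingHomomorphism R generator)

      -- Modulo the ideal each h_{n-k+j} may be replaced by `a j`, since their difference is a
      -- generator.
      s-reduce : (k>0 : k > 0) → k ≤ n → (μ : Vec ℕ k) → lookup μ (fromℕ< k>0) > n ∸ k →
        s (map +_ μ) Q.≈ Q.sum {k} (λ j →
          (Q.- Q.1#) Q.^ (k ∸ suc (toℕ j)) Q.* a j Q.*
          R.∑V n (+ n ℤ.- + k ℤ.+ + suc (toℕ j)) (λ τ → s (map +_ μ +ᵛ τ)))
      s-reduce k>0 k≤n μ μ₁>n∸k = Q.trans
        (Quotient.≈⇒∼ R generator (s-straighten n k>0 k≤n μ μ₁>n∸k))
        (Q.sum-cong-≋ {k} (λ j → Q.*-congʳ (Q.*-cong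
          (Residue.-1^-homo (k ∸ suc (toℕ j)))
          (Quotient.mk∼ (generator∈ideal R generator j)))))

-- Identification of h_m with `Hℕ` at the variables x₁, ..., x_k.

module PolynomialVariables {c ℓ} (𝐤 : CommutativeRing c ℓ) (k : ℕ) where

  private module K = CommutativeRing 𝐤
  open Polynomials 𝐤 k
  private module P = CommutativeRing polynomialRing
  open CompleteHomogeneous polynomialRing
  open Complete 𝐤 using (hᵖ)

  Additive : ∀ {j} → (Exp j → Exp k) → Set
  Additive g = ∀ e f → g (e ⊕ f) ≡ g e ⊕ g f

  monomials : ∀ {j} → (Exp j → Exp k) → List (Exp j) → Poly
  monomials g = List.map (λ e → K.1# , g e)

  -- `g` embeds exponent vectors in the remaining `j` variables into those in all `k`, so the
  -- recursion on `j` stays inside one polynomial ring.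
  variables : ∀ j → (Exp j → Exp k) → Vec Poly j
  variables zero    g = []
  variables (suc j) g = List.[ K.1# , g (1 ∷ 𝟘) ] ∷ variables j (g ∘ (0 ∷_))

  ∷-cong : ∀ {x y e p q} → x K.≈ y → p ≈ᵖ q → (x , e) List.∷ p ≈ᵖ (y , e) List.∷ q
  ∷-cong x≈y p≈q = mk≈ λ m → K.+-cong (K.*-congʳ x≈y) (coeff≈ p≈q m)

  monomials-incr : ∀ {j} (g : Exp (suc j) → Exp k) → Additive g → ∀ es →
    monomials g (List.map incr es) ≈ᵖ List.[ K.1# , g (1 ∷ 𝟘) ] *ᵖ monomials g es
  monomials-incr g g-+ List.[] = P.refl
  -- The raised exponent vector is the sum of `1 ∷ 𝟘` and `i ∷ e`, and additivity of `g` turns it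
  -- into the exponent of a product with the first variable.
  monomials-incr {j} g g-+ ((i ∷ e) List.∷ es) rewrite
    ≡.trans (≡.cong (λ f → g (suc i ∷ f)) (≡.sym (⊕-identityˡ e))) (g-+ (1 ∷ 𝟘) (i ∷ e)) =
    ∷-cong (K.sym (K.*-identityˡ K.1#)) (monomials-incr g g-+ es)

  -- `exponents` lists the vectors with first entry 0 before those with positive first entry. These
  -- two blocks are the two terms of the recursion of `Hℕ`, in the opposite order.
  monomials≈Hℕ : ∀ j (g : Exp j → Exp k) → Additive g → g 𝟘 ≡ 𝟘 → ∀ i →
                 monomials g (exponents j i) ≈ᵖ Hℕ (variables j g) i
  monomials≈Hℕ zero    g g-+ g-𝟘 zero    = P.reflexive (≡.cong (λ e → List.[ K.1# , e ]) g-𝟘)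
  monomials≈Hℕ zero    g g-+ g-𝟘 (suc i) = P.refl
  monomials≈Hℕ (suc j) g g-+ g-𝟘 zero    = P.trans
    (P.reflexive (≡.sym (Listₚ.map-∘ (exponents j 0))))
    (monomials≈Hℕ j (g ∘ (0 ∷_)) (λ e f → g-+ (0 ∷ e) (0 ∷ f)) g-𝟘 0)
  monomials≈Hℕ (suc j) g g-+ g-𝟘 (suc i) = P.trans
    (P.reflexive (Listₚ.map-++ _ (List.map (0 ∷_) (exponents j (suc i))) (List.map incr (exponents (suc j) i))))
    (P.trans (P.+-comm (monomials g (List.map (0 ∷_) (exponents j (suc i)))) _) (P.+-cong
      (P.trans (monomials-incr g g-+ (exponents (suc j) i))
        (P.*-congˡ {x = List.[ K.1# , g (1 ∷ 𝟘) ]} (monomials≈Hℕ (suc j) g g-+ g-𝟘 i)))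
      (P.trans (P.reflexive (≡.sym (Listₚ.map-∘ (exponents j (suc i)))))
        (monomials≈Hℕ j (g ∘ (0 ∷_)) (λ e f → g-+ (0 ∷ e) (0 ∷ f)) g-𝟘 (suc i)))))

  xs : Vec Poly k
  xs = variables k id

  hᵖ≈Hℕ : ∀ i → hᵖ k i ≈ᵖ Hℕ xs i
  hᵖ≈Hℕ = monomials≈Hℕ k id (λ e f → ≡.refl) ≡.refl

  underlying-isRingMonomorphism :
    RingMorphisms.IsRingMonomorphism (CommutativeRing.rawRing symmetricRing) P.rawRing proj₁
  underlying-isRingMonomorphism = record
    { isRingHomomorphism = record
      { isSemiringHomomorphism = record
        { isNearSemiringHomomorphism = record
          { +-isMonoidHomomorphism = record
            { isMagmaHomomorphism = record
              { isRelHomomorphism = record { cong = id }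
              ; homo = λ p q → P.refl }
            ; ε-homo = P.refl }
          ; *-homo = λ p q → P.refl }
        ; 1#-homo = P.refl }
      ; -‿homo = λ p → P.refl }
    ; injective = id }

theorem11p12 : ∀ {c ℓ} (𝐤 : CommutativeRing c ℓ) (k n : ℕ) (k>0 : k > 0) → k ≤ n →
    (a : Fin k → CommutativeRing.Carrier 𝐤) →
    (μ : Vec ℕ k) → IsPartition μ → lookup μ (fromℕ< k>0) > n ∸ k →
    let open Setup 𝐤 k n a in
    residue (s (map +_ μ))
    ≈ (∑[ j < k ] ((- 1#) ^ (k ∸ suc (toℕ j)) * residue (constˢ (a j))
    * ∑V (n-k+ j) (λ τ → residue (s (map +_ μ +ᵛ τ)))))
theorem11p12 𝐤 k n k>0 k≤n a μ _ =
  -- `residue` returns its argument and 𝒮/I keeps the operations of 𝒮, so the general reduction,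
  -- taken at the constants `constˢ (a j)`, matches the claim by computation.
  StraighteningInSubring.s-reduce symmetricRing polynomialRing underlying-isRingMonomorphism
    xs h h≈H n (λ j → constˢ (a j)) k>0 k≤n μ
  where
  open Setup 𝐤 k n a using (h)
  open Polynomials 𝐤 k using (polynomialRing; symmetricRing; constˢ)
  open PolynomialVariables 𝐤 k
  open CompleteHomogeneous polynomialRing using (H)

  h≈H : ∀ i → CommutativeRing._≈_ polynomialRing (proj₁ (h i)) (H xs i)
  h≈H (+ i)    = hᵖ≈Hℕ i
  h≈H -[1+ i ] = CommutativeRing.refl polynomialRing
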